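{- Let $q=2^m>2$, and let $\mathcal{U}_1=\mathcal{U}_{1,b}$ and $\mathcal{U}_2=\mathcal{U}_{1,b'}$ be any two non-classical orthogonal Buekenhout–Metz unitals of $\mathrm{PG}(2,q^2)$. Then $\mathcal{U}_1$ and $\mathcal{U}_2$ contain the same number of BM-special Fano planes.
   Context: Let $q=2^m$. The absolute trace of $x\in\mathbb{F}_q$ is $x+x^2+x^{4}+\cdots+x^{2^{m-1}}$. For $a,b\in\mathbb{F}_{q^2}$ with $b^q\neq b$ and $d=a^{q+1}/(b^q+b)^2$ of absolute trace $0$, the orthogonal Buekenhout–Metz (BM) unital is $\mathcal{U}_{a,b}=\{(x,ax^2+bx^{q+1}+r,1)\colon r\in\mathbb{F}_q,\ x\in\mathbb{F}_{q^2}\}\cup\{T_\infty=(0,1,0)\}$ in $\mathrm{PG}(2,q^2)$; it is a unital (a $2$-$(q^3+1,q+1,1)$ design whose blocks are its intersections of size $q+1$ with lines of $\mathrm{PG}(2,q^2)$), it is classical iff $a=0$, and $T_\infty$ is its special point. A Fano plane contained in the unital is a set of seven points of the unital and seven lines of $\mathrm{PG}(2,q^2)$, each line containing exactly three of the points, with the incidence structure of $\mathrm{PG}(2,2)$. Such a Fano plane is BM-special if one of its seven lines, as a line of $\mathrm{PG}(2,q^2)$, contains $T_\infty$. -}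

module Defs where

open import Data.Nat as ℕ using (ℕ; zero; suc)
import Data.Bool
open import Data.Bool using (Bool; true; false; _∧_; _∨_; not)
open import Data.Fin using (Fin; toℕ; #_)
import Data.Fin
open import Data.Product using (_×_; _,_; ∃)
import Data.List
open import Data.List using (List; []; _∷_; map; filter; concatMap; _++_; length; upTo; foldr)
open import Data.Bool.ListAction using (all; any)
open import Data.List.Membership.Propositional using (_∈_)
open import Data.List.Relation.Unary.Unique.Propositional using (Unique)
open import Data.Vec using (Vec; lookup) renaming ([] to []ᵥ; _∷_ to _∷ᵥ_)
open import Relation.Binary.PropositionalEquality using (_≡_; _≢_)
open import Relation.Binary.Definitions using (DecidableEquality)
open import Relation.Nullary.Decidable using (⌊_⌋)
open import Algebra.Structures using (IsCommutativeRing)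

choose : ∀ {A : Set} (k : ℕ) → List A → List (Vec A k)
choose zero    _        = []ᵥ ∷ []
choose (suc k) []       = []
choose (suc k) (x ∷ xs) = map (x ∷ᵥ_) (choose k xs) ++ choose (suc k) xs

insertAll : ∀ {A : Set} {n : ℕ} → A → Vec A n → List (Vec A (suc n))
insertAll x []ᵥ        = (x ∷ᵥ []ᵥ) ∷ []
insertAll x (y ∷ᵥ ys) = (x ∷ᵥ y ∷ᵥ ys) ∷ map (y ∷ᵥ_) (insertAll x ys)

perms : ∀ {A : Set} {n : ℕ} → Vec A n → List (Vec A n)
perms []ᵥ        = []ᵥ ∷ []
perms (x ∷ᵥ xs) = concatMap (insertAll x) (perms xs)

FanoLine : Set
FanoLine = Fin 7 × Fin 7 × Fin 7

fanoLines : List FanoLine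
fanoLines =
  (0F , 1F , 2F) ∷ (0F , 3F , 4F) ∷ (0F , 5F , 6F) ∷ (1F , 3F , 5F) ∷
  (1F , 4F , 6F) ∷ (2F , 3F , 6F) ∷ (2F , 4F , 5F) ∷ []
  where
  0F 1F 2F 3F 4F 5F 6F : Fin 7
  0F = # 0
  1F = # 1
  2F = # 2
  3F = # 3
  4F = # 4
  5F = # 5
  6F = # 6

allFin7 : List (Fin 7)
allFin7 = Data.List.tabulate (λ i → i)

_==ᶠ_ : Fin 7 → Fin 7 → Bool
i ==ᶠ j = ⌊ toℕ i ℕ.≟ toℕ j ⌋

onLine : Fin 7 → FanoLine → Bool
onLine p (i , j , k) = (p ==ᶠ i) ∨ (p ==ᶠ j) ∨ (p ==ᶠ k)

record FiniteField (m : ℕ) : Set₁ where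
  infixl 6 _+_
  infixl 7 _*_
  infix 4 _≟_
  field
    Carrier : Set
    _+_ _*_ : Carrier → Carrier → Carrier
    -_      : Carrier → Carrier
    0# 1#   : Carrier
    isCommutativeRing : IsCommutativeRing _≡_ _+_ _*_ -_ 0# 1#
    0≢1     : 0# ≢ 1#
    inverse : ∀ x → x ≢ 0# → ∃ λ y → x * y ≡ 1#
    _≟_     : DecidableEquality Carrier
    elems    : List Carrier
    complete : ∀ x → x ∈ elems
    unique   : Unique elems
    order    : length elems ≡ (2 ℕ.^ m) ℕ.* (2 ℕ.^ m)

  q : ℕ
  q = 2 ℕ.^ m

  infixr 8 _^_
  _^_ : Carrier → ℕ → Carrier
  x ^ zero  = 1#
  x ^ suc n = x * (x ^ n)

  _==_ : Carrier → Carrier → Bool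
  x == y = ⌊ x ≟ y ⌋

  Fq : List Carrier
  Fq = filter (λ r → r ^ q ≟ r) elems

  trace : Carrier → Carrier
  trace x = foldr (λ i s → (x ^ (2 ℕ.^ i)) + s) 0# (upTo m)

  -- homogeneous coordinates of points of PG(2,q²)
  Point : Set
  Point = Carrier × Carrier × Carrier

  det : Point → Point → Point → Carrier
  det (x₁ , y₁ , z₁) (x₂ , y₂ , z₂) (x₃ , y₃ , z₃) =
    x₁ * (y₂ * z₃ + - (z₂ * y₃))
    + - (y₁ * (x₂ * z₃ + - (z₂ * x₃)))
    + z₁ * (x₂ * y₃ + - (y₂ * x₃))

  collinear : Point → Point → Point → Bool
  collinear P Q R = det P Q R == 0#

  samePoint : Point → Point → Bool
  samePoint (x₁ , y₁ , z₁) (x₂ , y₂ , z₂) =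
    ((x₁ * y₂) == (y₁ * x₂)) ∧ ((x₁ * z₂) == (z₁ * x₂)) ∧ ((y₁ * z₂) == (z₁ * y₂))

  T∞ : Point
  T∞ = (0# , 1# , 0#)

  -- The BM unital U_{a,b} as a list of its q³+1 points (each once)
  unitalPoints : Carrier → Carrier → List Point
  unitalPoints a b =
    T∞ ∷ concatMap (λ x → map (λ r → (x , a * (x ^ 2) + b * (x ^ (q ℕ.+ 1)) + r , 1#)) Fq) elems

  IsOrthogonalBM : Carrier → Carrier → Set
  IsOrthogonalBM a b =
    ((b ^ q) ≢ b) ×
    (∀ d → d * ((b ^ q + b) ^ 2) ≡ a ^ (q ℕ.+ 1) → trace d ≡ 0#)

  -- f labels 7 points of PG(2,q²) by the points of PG(2,2) so that the
  -- seven lines of PG(2,q²) spanned by the images of the Fano lines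
  -- contain exactly the images of the points of the respective Fano line:
  -- the points are pairwise distinct, and for each Fano line {i,j,k},
  -- a point f p lies on the line f i f j iff p ∈ {i,j,k}.
  isFanoLabelling : (Fin 7 → Point) → Bool
  isFanoLabelling f =
    all (λ i → all (λ j → (i ==ᶠ j) ∨ not (samePoint (f i) (f j))) allFin7) allFin7
    ∧ all (λ { (i , j , k) →
           all (λ p → onLine p (i , j , k) ∨ not (collinear (f i) (f j) (f p))) allFin7
           ∧ collinear (f i) (f j) (f k) }) fanoLines

  hasLineThroughT∞ : (Fin 7 → Point) → Bool
  hasLineThroughT∞ f = any (λ { (i , j , k) → collinear (f i) (f j) T∞ }) fanoLines

  isBMSpecialFano : Vec Point 7 → Bool
  isBMSpecialFano S =
    any (λ v → isFanoLabelling (lookup v) ∧ hasLineThroughT∞ (lookup v)) (perms S)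

  -- number of BM-special Fano planes contained in U_{a,b}
  -- (a Fano plane is determined by its seven points, its lines being
  -- spanned by them; so we count 7-subsets of the unital)
  numBMSpecialFano : Carrier → Carrier → ℕ
  numBMSpecialFano a b =
    length (filter (λ S → Data.Bool._≟_ (isBMSpecialFano S) true) (choose 7 (unitalPoints a b)))

{-# OPTIONS --safe #-}
-- Write c̄ = c^q, T and N for the trace and the norm to 𝔽_q, and β = T b. An affine point (x, y, 1) lies
-- on 𝒰_{1,b} iff T y = T(x)² + β N(x), and the trace condition makes this quadratic form anisotropic.
-- Consequently no secant carries a third point with parameter in 𝔽_q, so that T∞ is never a point of
-- a Fano plane in 𝒰_{1,b}. In a BM-special Fano plane three points are on a line x = c and the other
-- four form a quadrangle with diagonal points there. Its incidences put the inverses 1/(xⱼ + c) on a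
-- line of AG(2,q) missing 0, which is equivalent to the existence of a (unique) h with
-- T(h (x + c)) = N(x) + N(c) at all seven points. The collineation (x, y) ↦ (x, y + k x + s) with
-- k = (β + β′) h, s = k c + (b + b′) N(c) then carries the Fano plane to one of 𝒰_{1,b′}. Because c and
-- h can be read off the x-coordinates, which are preserved, different Fano planes have different
-- images. Hence each of the two numbers is at most the other.
module Submission where

open import Defs
open import Algebra.Bundles using (CommutativeRing; RawRing)
import Algebra.Properties.Ring
import Algebra.Properties.Semiring.Mult
import Algebra.Solver.Ring
open import Algebra.Solver.Ring.AlmostCommutativeRing using (fromCommutativeRing;
  _-Raw-AlmostCommutative⟶_)
open import Algebra.Structures using (IsCommutativeMonoid)
open import Data.Bool using (Bool; true; false; _∧_; _∨_; _xor_; not)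
open import Data.Bool.ListAction using (all; any)
open import Data.Empty using (⊥)
open import Data.Fin using (Fin; zero; suc; #_; toℕ)
open import Data.Fin.Patterns using (0F; 1F; 2F; 3F; 4F; 5F; 6F)
import Data.Fin.Properties as Finₚ
open import Data.List as List using (List; []; _∷_; length; _++_; concatMap; map; foldr; filter;
  applyUpTo)
import Data.List.Membership.DecPropositional as DecMembership
open import Data.List.Membership.Propositional using (_∈_; find; lose)
open import Data.List.Membership.Propositional.Properties using (∈-∃++; ∈-++⁻; ∈-++⁺ˡ; ∈-++⁺ʳ;
  ∈-map⁺; ∈-map⁻; ∈-concatMap⁺; ∈-concatMap⁻; ∈-tabulate⁺; ∈-filter⁺; ∈-filter⁻)
open import Data.List.Membership.Propositional.Properties.WithK using (unique∧set⇒bag)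
open import Data.List.Properties using (length-++)
open import Data.List.Relation.Binary.BagAndSetEquality using (∼bag⇒↭)
open import Data.List.Relation.Binary.Permutation.Propositional using (_↭_; ↭-sym; ↭-trans; ↭⇒↭ₛ)
open import Data.List.Relation.Binary.Permutation.Propositional.Properties using (shift; drop-∷;
  map⁺; ↭-length)
import Data.List.Relation.Binary.Permutation.Setoid.Properties as Permutationₛ
open import Data.List.Relation.Unary.All as All using (All; []; _∷_)
import Data.List.Relation.Unary.All.Properties as Allₚ
open import Data.List.Relation.Unary.AllPairs as AllPairs using ([]; _∷_; AllPairs)
import Data.List.Relation.Unary.AllPairs.Properties as AllPairsₚ
open import Data.List.Relation.Unary.Any as Any using (Any; here; there)
open import Data.List.Relation.Unary.Unique.Propositional using (Unique)
open import Data.List.Relation.Unary.Unique.Propositional.Properties as Uniqueₚ using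
  (Unique[x∷xs]⇒x∉xs)
open import Data.Maybe using (Maybe; just; nothing)
open import Data.Nat as ℕ using (ℕ; zero; suc; _≤_; z≤n; s≤s)
import Data.Nat.Properties as ℕₚ
open import Data.Product using (_×_; _,_; ∃; proj₁; proj₂; ∃₂)
open import Data.Product.Properties using (≡-dec)
open import Data.Sum using (_⊎_; inj₁; inj₂)
open import Data.Vec as Vec using (Vec; []; _∷_; lookup)
import Data.Vec.Membership.Propositional as Vec∈
open import Data.Vec.Membership.Propositional.Properties using (∈-lookup) renaming (∈-map⁺ to
  ∈ᵥ-map⁺)
open import Data.Vec.Properties using (∷-injectiveʳ; lookup-map)
import Data.Vec.Relation.Unary.All as VAll
import Data.Vec.Relation.Unary.All.Properties as VAllₚ
import Data.Vec.Relation.Unary.AllPairs as VAP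
import Data.Vec.Relation.Unary.Any as VAny
import Data.Vec.Relation.Unary.Any.Properties as VAnyₚ
import Data.Vec.Relation.Unary.Unique.Propositional as VUnique
open import Function using (_∘_; mk⇔; id)
open import Relation.Binary.Definitions using (DecidableEquality)
open import Relation.Binary.PropositionalEquality
open import Relation.Nullary using (¬_; yes; no; contradiction; Dec)
open import Relation.Nullary.Decidable using (_×-dec_; _→-dec_; from-yes; isYes≗does; dec-true;
  dec-false)

open VAny using (here; there)
open VAll using ([]; _∷_)
open VAP using ([]; _∷_)

-- Over the same x the two unitals require T y = T(x)² + β N(x) and T y = T(x)² + β′ N(x), so a map
-- (x, y) ↦ (x, y + k x + s) is right at x exactly when T(k x + s) = (β + β′) N(x). The left side is
-- 𝔽_q-affine in x and the norm is not, so for β ≠ β′ no single map of this kind serves the whole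
-- unital: it has to be fitted to each Fano plane. Different planes then undergo different
-- collineations, which is why injectivity needs an argument. The data that survive in the image are
-- these: c is the only x-coordinate that occurs more than once, and the equation for h at two
-- points with x₁ + c and x₂ + c independent over 𝔽_q determines h. Since the map is fitted through
-- some labelling of the plane, the correspondence is kept as a relation between point sets, and the
-- two counts are compared along that relation.

-- Comparing lengths along an injective relation

module _ {A B : Set} (R : A → B → Set) where

  -- Induction on `xs` deletes from `ys` the partner of the head. No later element loses its partner
  -- by this: sharing the deleted occurrence would identify it with the head, against uniqueness.
  length-≤ : (xs : List A) (ys : List B) → Unique xs →
             (∀ {x} → x ∈ xs → ∃ λ y → y ∈ ys × R x y) →
             (∀ {x x′ y} → x ∈ xs → x′ ∈ xs → R x y → R x′ y → x ≡ x′) →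
             length xs ≤ length ys
  length-≤ []       ys _ _ _ = z≤n
  length-≤ (x ∷ xs) ys uxs@(_ ∷ u) total injective
    with y , y∈ , Rxy ← total (here refl)
    with as , bs , refl ← ∈-∃++ y∈ =
      subst (suc (length xs) ≤_) (sym lengths)
        (s≤s (length-≤ xs (as ++ bs) u total′
               (λ p p′ → injective (there p) (there p′))))
    where
    lengths : length (as ++ y ∷ bs) ≡ suc (length (as ++ bs))
    lengths = trans (length-++ as) (trans (ℕₚ.+-suc (length as) (length bs))
                                         (cong suc (sym (length-++ as))))
    total′ : ∀ {x′} → x′ ∈ xs → ∃ λ y′ → y′ ∈ as ++ bs × R x′ y′
    total′ x′∈ with y′ , y′∈ , r ← total (there x′∈) with ∈-++⁻ as y′∈
    ... | inj₁ p           = y′ , ∈-++⁺ˡ p , r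
    ... | inj₂ (there p)   = y′ , ∈-++⁺ʳ as p , r
    ... | inj₂ (here refl) = contradiction
          (subst (_∈ xs) (sym (injective (here refl) (there x′∈) Rxy r)) x′∈)
          (Unique[x∷xs]⇒x∉xs uxs)

-- Sublists and permutations as encodings of finite sets

module _ {A : Set} where

  choose-⊆ : ∀ k (xs : List A) {v : Vec A k} {x} → v ∈ choose k xs → x Vec∈.∈ v → x ∈ xs
  choose-⊆ zero    xs       (here refl) ()
  choose-⊆ (suc k) (y ∷ xs) v∈ x∈ with ∈-++⁻ (List.map (y ∷_) (choose k xs)) v∈
  ... | inj₂ p = there (choose-⊆ (suc k) xs p x∈)
  ... | inj₁ p with w , w∈ , refl ← ∈-map⁻ (y ∷_) p with x∈
  ...   | here eq = here eq
  ...   | there r = there (choose-⊆ k xs w∈ r)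

  choose-unique : ∀ k (xs : List A) → Unique xs → Unique (choose k xs)
  choose-unique zero    xs       u = [] ∷ []
  choose-unique (suc k) []       u = []
  choose-unique (suc k) (y ∷ xs) uxs@(_ ∷ u) =
    Uniqueₚ.++⁺ (Uniqueₚ.map⁺ ∷-injectiveʳ (choose-unique k xs u))
                (choose-unique (suc k) xs u) disjoint
    where
    disjoint : ∀ {v} → ¬ (v ∈ List.map (y ∷_) (choose k xs) × v ∈ choose (suc k) xs)
    disjoint (p , q) with w , w∈ , refl ← ∈-map⁻ (y ∷_) p =
      Unique[x∷xs]⇒x∉xs uxs (choose-⊆ (suc k) xs q (here refl))

  -- Members of `choose k xs` keep the order of `xs`, so only their sets of entries can differ. This
  -- turns equality of point sets into equality of counted vectors.
  choose-ext : ∀ k (xs : List A) → Unique xs → ∀ {v w} → v ∈ choose k xs → w ∈ choose k xs →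
               (∀ {x} → x Vec∈.∈ v → x Vec∈.∈ w) → (∀ {x} → x Vec∈.∈ w → x Vec∈.∈ v) → v ≡ w
  choose-ext zero    xs       u (here refl) (here refl) _ _ = refl
  choose-ext (suc k) (y ∷ xs) uxs@(_ ∷ u) v∈ w∈ v⊆w w⊆v
    with ∈-++⁻ (List.map (y ∷_) (choose k xs)) v∈ | ∈-++⁻ (List.map (y ∷_) (choose k xs)) w∈
  ... | inj₂ p | inj₂ r = choose-ext (suc k) xs u p r v⊆w w⊆v
  ... | inj₁ p | inj₂ r with v′ , _ , refl ← ∈-map⁻ (y ∷_) p =
    contradiction (choose-⊆ (suc k) xs r (v⊆w (here refl))) (Unique[x∷xs]⇒x∉xs uxs)
  ... | inj₂ p | inj₁ r with w′ , _ , refl ← ∈-map⁻ (y ∷_) r =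
    contradiction (choose-⊆ (suc k) xs p (w⊆v (here refl))) (Unique[x∷xs]⇒x∉xs uxs)
  ... | inj₁ p | inj₁ r with v′ , v′∈ , refl ← ∈-map⁻ (y ∷_) p
                        with w′ , w′∈ , refl ← ∈-map⁻ (y ∷_) r =
    cong (y ∷_) (choose-ext k xs u v′∈ w′∈ (tails v′∈ v⊆w) (tails w′∈ w⊆v))
    where
    tails : ∀ {s t : Vec A k} → s ∈ choose k xs →
            (∀ {x} → x Vec∈.∈ (y ∷ s) → x Vec∈.∈ (y ∷ t)) → ∀ {x} → x Vec∈.∈ s → x Vec∈.∈ t
    tails s∈ s⊆t x∈ with s⊆t (there x∈)
    ... | there r   = r
    ... | here refl = contradiction (choose-⊆ k xs s∈ x∈) (Unique[x∷xs]⇒x∉xs uxs)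

  insertAll-∈⁻ : ∀ {n} x (v : Vec A n) {w y} → w ∈ insertAll x v → y Vec∈.∈ w → y Vec∈.∈ (x ∷ v)
  insertAll-∈⁻ x []      (here refl) y∈ = y∈
  insertAll-∈⁻ x (z ∷ v) (here refl) y∈ = y∈
  insertAll-∈⁻ x (z ∷ v) (there p)   y∈ with w′ , w′∈ , refl ← ∈-map⁻ (z ∷_) p with y∈
  ... | here eq = there (here eq)
  ... | there r with insertAll-∈⁻ x v w′∈ r
  ...   | here eq = here eq
  ...   | there s = there (there s)

  insertAll-∈⁺ : ∀ {n} x (v : Vec A n) {w y} → w ∈ insertAll x v → y Vec∈.∈ (x ∷ v) → y Vec∈.∈ w
  insertAll-∈⁺ x []      (here refl) y∈ = y∈
  insertAll-∈⁺ x (z ∷ v) (here refl) y∈ = y∈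
  insertAll-∈⁺ x (z ∷ v) (there p)   y∈ with w′ , w′∈ , refl ← ∈-map⁻ (z ∷_) p with y∈
  ... | here eq         = there (insertAll-∈⁺ x v w′∈ (here eq))
  ... | there (here eq) = here eq
  ... | there (there r) = there (insertAll-∈⁺ x v w′∈ (there r))

  perms-∈⁻ : ∀ {n} (v : Vec A n) {w y} → w ∈ perms v → y Vec∈.∈ w → y Vec∈.∈ v
  perms-∈⁻ []      (here refl) y∈ = y∈
  perms-∈⁻ (x ∷ v) w∈ y∈
    with u , u∈ , p ← find (∈-concatMap⁻ (insertAll x) {xs = perms v} w∈) with insertAll-∈⁻ x u p y∈
  ... | here eq = here eq
  ... | there r = there (perms-∈⁻ v u∈ r)

  perms-∈⁺ : ∀ {n} (v : Vec A n) {w y} → w ∈ perms v → y Vec∈.∈ v → y Vec∈.∈ w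
  perms-∈⁺ []      (here refl) y∈ = y∈
  perms-∈⁺ (x ∷ v) w∈ y∈
    with u , u∈ , p ← find (∈-concatMap⁻ (insertAll x) {xs = perms v} w∈) with y∈
  ... | here eq = insertAll-∈⁺ x u p (here eq)
  ... | there r = insertAll-∈⁺ x u p (there (perms-∈⁺ v u∈ r))

  -- Inverts `insertAll`. That x is absent from the remainder lets `choose-perms` continue with a
  -- list from which x has been dropped.
  extract : ∀ {n x} (w : Vec A (suc n)) → VUnique.Unique w → x Vec∈.∈ w →
            ∃ λ w′ → w ∈ insertAll x w′ × VUnique.Unique w′ × VAll.All (x ≢_) w′ ×
                     (∀ {y} → y Vec∈.∈ w′ → y Vec∈.∈ w)
  extract (y ∷ [])    (d ∷ u) (here refl) = [] , here refl , u , d , there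
  extract (y ∷ z ∷ w) (d ∷ u) (here refl) = z ∷ w , here refl , u , d , there
  extract (y ∷ z ∷ w) (d ∷ u) (there x∈) with w′ , p , u′ , d′ , sub ← extract (z ∷ w) u x∈ =
    y ∷ w′ , there (∈-map⁺ (y ∷_) p) ,
    VAllₚ.lookup⁻ (λ i → VAll.lookup d (sub (∈-lookup i w′))) ∷ u′ ,
    (λ eq → VAll.lookup d x∈ (sym eq)) ∷ d′ ,
    λ { (here eq) → here eq ; (there r) → there (sub r) }

  -- The image of a labelled plane is a vector in arbitrary order, whereas the count runs over
  -- vectors in the order of the unital; this finds the counted vector with the same points.
  choose-perms : DecidableEquality A → ∀ k (xs : List A) (w : Vec A k) → VUnique.Unique w →
                 (∀ {x} → x Vec∈.∈ w → x ∈ xs) → ∃ λ v → v ∈ choose k xs × w ∈ perms v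
  choose-perms _≟_ zero    xs       []      _ _ = [] , here refl , here refl
  choose-perms _≟_ (suc k) []       (y ∷ w) _ w⊆ with () ← w⊆ (here refl)
  choose-perms _≟_ (suc k) (x ∷ xs) w u w⊆ with VAny.any? (x ≟_) w
  ... | yes x∈ with w′ , p , u′ , d′ , sub ← extract w u x∈
               with v , v∈ , q ← choose-perms _≟_ k xs w′ u′
                      (λ r → Any.tail (λ eq → VAll.lookup d′ r (sym eq)) (w⊆ (sub r))) =
    x ∷ v , ∈-++⁺ˡ (∈-map⁺ (x ∷_) v∈) , ∈-concatMap⁺ (insertAll x) (lose q p)
  ... | no  x∉ with v , v∈ , q ← choose-perms _≟_ (suc k) xs w u
                      (λ r → Any.tail (λ eq → x∉ (subst (Vec∈._∈ w) eq r)) (w⊆ r)) =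
    v , ∈-++⁺ʳ (List.map (x ∷_) (choose k xs)) v∈ , q

-- Boolean quantifiers over lists

module _ {A : Set} where

  any⁻ : (p : A → Bool) (xs : List A) → any p xs ≡ true → ∃ λ x → x ∈ xs × p x ≡ true
  any⁻ p (x ∷ xs) eq with p x in px
  ... | true  = x , here refl , px
  ... | false with y , y∈ , py ← any⁻ p xs eq = y , there y∈ , py

  any⁺ : (p : A → Bool) {xs : List A} {x : A} → x ∈ xs → p x ≡ true → any p xs ≡ true
  any⁺ p (here refl) px rewrite px = refl
  any⁺ p {y ∷ _} (there x∈) px with p y
  ... | true  = refl
  ... | false = any⁺ p x∈ px

  all⁻ : (p : A → Bool) {xs : List A} {x : A} → all p xs ≡ true → x ∈ xs → p x ≡ true
  all⁻ p {y ∷ _} eq x∈ with p y in py | x∈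
  ... | true | here refl = py
  ... | true | there r   = all⁻ p eq r

  all-cong : {p p′ : A → Bool} (xs : List A) → (∀ x → p x ≡ p′ x) → all p xs ≡ all p′ xs
  all-cong []       eq = refl
  all-cong (x ∷ xs) eq = cong₂ _∧_ (eq x) (all-cong xs eq)

  any-cong : {p p′ : A → Bool} (xs : List A) → (∀ x → p x ≡ p′ x) → any p xs ≡ any p′ xs
  any-cong []       eq = refl
  any-cong (x ∷ xs) eq = cong₂ _∨_ (eq x) (any-cong xs eq)

-- Fields of order q²: characteristic 2 and Fermat's theorem

module Folding {A : Set} (_∙_ : A → A → A) (ε : A)
  (isCM : IsCommutativeMonoid _≡_ _∙_ ε) where

  open IsCommutativeMonoid isCM using (assoc; comm; identityˡ)

  power : A → ℕ → A
  power x zero    = ε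
  power x (suc n) = x ∙ power x n

  foldr-↭ : ∀ {xs ys} → xs ↭ ys → foldr _∙_ ε xs ≡ foldr _∙_ ε ys
  foldr-↭ p = Permutationₛ.foldr-commMonoid (setoid A) isCM (↭⇒↭ₛ p)

  -- Whenever x ∙_ permutes `ys`, cancelling the fold leaves `power x (length ys)` equal to `ε`.
  -- Used additively for `order·1≡0` and multiplicatively for `fermat`.
  foldr-translate : ∀ x ys → foldr _∙_ ε (map (x ∙_) ys) ≡ power x (length ys) ∙ foldr _∙_ ε ys
  foldr-translate x []       = sym (identityˡ ε)
  foldr-translate x (y ∷ ys) = begin
    (x ∙ y) ∙ foldr _∙_ ε (map (x ∙_) ys)  ≡⟨ cong ((x ∙ y) ∙_) (foldr-translate x ys) ⟩
    (x ∙ y) ∙ (p ∙ s)                      ≡⟨ assoc x y (p ∙ s) ⟩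
    x ∙ (y ∙ (p ∙ s))                      ≡⟨ cong (x ∙_) (sym (assoc y p s)) ⟩
    x ∙ ((y ∙ p) ∙ s)                      ≡⟨ cong (λ t → x ∙ (t ∙ s)) (comm y p) ⟩
    x ∙ ((p ∙ y) ∙ s)                      ≡⟨ cong (x ∙_) (assoc p y s) ⟩
    x ∙ (p ∙ (y ∙ s))                      ≡⟨ assoc x p (y ∙ s) ⟨
    (x ∙ p) ∙ (y ∙ s)                      ∎
    where
    open ≡-Reasoning
    p = power x (length ys)
    s = foldr _∙_ ε ys

module FieldProperties {m : ℕ} (F : FiniteField m) where
  open FiniteField F

  commutativeRing : CommutativeRing _ _
  commutativeRing = record { isCommutativeRing = isCommutativeRing }

  open CommutativeRing commutativeRing public
    using (+-assoc; +-comm; +-identityˡ; +-identityʳ; *-assoc; *-comm; *-identityˡ; *-identityʳ;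
           zeroˡ; zeroʳ; distribˡ; distribʳ; -‿inverseˡ; -‿inverseʳ)
  open CommutativeRing commutativeRing
    using (ring; semiring; +-isCommutativeMonoid; *-isCommutativeMonoid)
  open Algebra.Properties.Ring ring using (+-cancelʳ)
  open Algebra.Properties.Semiring.Mult semiring using (×1-homo-*) renaming (_×_ to _·_)

  _⁻¹ : Carrier → Carrier
  x ⁻¹ with x ≟ 0#
  -- A default value: the inverse laws all assume a nonzero argument.
  ... | yes _  = 0#
  ... | no x≢0 = proj₁ (inverse x x≢0)

  *-inverseʳ : ∀ {x} → x ≢ 0# → x * x ⁻¹ ≡ 1#
  *-inverseʳ {x} x≢0 with x ≟ 0#
  ... | yes x≡0 = contradiction x≡0 x≢0
  ... | no  x≢0′ = proj₂ (inverse x x≢0′)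

  *-inverseˡ : ∀ {x} → x ≢ 0# → x ⁻¹ * x ≡ 1#
  *-inverseˡ {x} x≢0 = trans (*-comm (x ⁻¹) x) (*-inverseʳ x≢0)

  *-cancelˡ : ∀ {x y z} → x ≢ 0# → x * y ≡ x * z → y ≡ z
  *-cancelˡ {x} {y} {z} x≢0 eq = trans (sym (lem y)) (trans (cong (x ⁻¹ *_) eq) (lem z))
    where
    lem : ∀ t → x ⁻¹ * (x * t) ≡ t
    lem t = trans (sym (*-assoc (x ⁻¹) x t)) (trans (cong (_* t) (*-inverseˡ x≢0)) (*-identityˡ t))

  *-zero-cancel : ∀ {x y} → x ≢ 0# → x * y ≡ 0# → y ≡ 0#
  *-zero-cancel {x} x≢0 eq = *-cancelˡ x≢0 (trans eq (sym (zeroʳ x)))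

  *≢0 : ∀ {x y} → x ≢ 0# → y ≢ 0# → x * y ≢ 0#
  *≢0 x≢0 y≢0 eq = y≢0 (*-zero-cancel x≢0 eq)

  elems-map-↭ : (f g : Carrier → Carrier) → (∀ x → f (g x) ≡ x) → (∀ x → g (f x) ≡ x) →
                map f elems ↭ elems
  elems-map-↭ f g fg gf = ∼bag⇒↭ (unique∧set⇒bag
    (Uniqueₚ.map⁺ (λ {x} {y} eq → trans (sym (gf x)) (trans (cong g eq) (gf y))) unique) unique
    (λ {x} → mk⇔ (λ _ → complete x)
                 (λ _ → subst (_∈ map f elems) (fg x) (∈-map⁺ f (complete (g x))))))

  module Σ = Folding _+_ 0# +-isCommutativeMonoid
  module Π = Folding _*_ 1# *-isCommutativeMonoid

  order·1≡0 : length elems · 1# ≡ 0#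
  order·1≡0 = +-cancelʳ (foldr _+_ 0# elems) (length elems · 1#) 0# (begin
    length elems · 1# + S       ≡⟨ cong (_+ S) (power≡· (length elems)) ⟨
    Σ.power 1# (length elems) + S ≡⟨ Σ.foldr-translate 1# elems ⟨
    foldr _+_ 0# (map (1# +_) elems) ≡⟨ Σ.foldr-↭ (elems-map-↭ (1# +_) (- 1# +_)
        (λ x → trans (sym (+-assoc 1# (- 1#) x)) (trans (cong (_+ x) (-‿inverseʳ 1#)) (+-identityˡ x)))
        (λ x → trans (sym (+-assoc (- 1#) 1# x)) (trans (cong (_+ x) (-‿inverseˡ 1#)) (+-identityˡ x)))) ⟩
    S                           ≡⟨ +-identityˡ S ⟨
    0# + S                      ∎)
    where
    open ≡-Reasoning
    S = foldr _+_ 0# elems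
    power≡· : ∀ n → Σ.power 1# n ≡ n · 1#
    power≡· zero    = refl
    power≡· (suc n) = cong (1# +_) (power≡· n)

  -- If 1 + 1 were nonzero, so would be its powers 2^n · 1, yet q² · 1 = 0 is the product of two
  -- copies of 2^m · 1.
  1+1≡0 : 1# + 1# ≡ 0#
  1+1≡0 with (1# + 1#) ≟ 0#
  ... | yes eq = eq
  ... | no  ne = contradiction
        (trans (sym (×1-homo-* (2 ℕ.^ m) (2 ℕ.^ m))) (subst (λ n → n · 1# ≡ 0#) order order·1≡0))
        (*≢0 (2^n·1≢0 m) (2^n·1≢0 m))
    where
    2^n·1≢0 : ∀ n → (2 ℕ.^ n) · 1# ≢ 0#
    2^n·1≢0 zero    eq = 0≢1 (trans (sym eq) (+-identityʳ 1#))
    2^n·1≢0 (suc n) eq = *≢0 ne (2^n·1≢0 n) (trans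
      (cong (λ t → t * ((2 ℕ.^ n) · 1#)) (cong (1# +_) (sym (+-identityʳ 1#))))
      (trans (sym (×1-homo-* 2 (2 ℕ.^ n))) eq))

  x+x≡0 : ∀ x → x + x ≡ 0#
  x+x≡0 x = begin
    x + x           ≡⟨ cong₂ _+_ (*-identityˡ x) (*-identityˡ x) ⟨
    1# * x + 1# * x ≡⟨ distribʳ x 1# 1# ⟨
    (1# + 1#) * x   ≡⟨ cong (_* x) 1+1≡0 ⟩
    0# * x          ≡⟨ zeroˡ x ⟩
    0#              ∎
    where open ≡-Reasoning

  -x≡x : ∀ x → - x ≡ x
  -x≡x x = +-cancelʳ x (- x) x (trans (-‿inverseˡ x) (sym (x+x≡0 x)))

  -- Coefficients in 𝔽₂ let the solver use x + x = 0.
  module Solver where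

    𝔽₂ : RawRing _ _
    𝔽₂ = record { Carrier = Bool ; _≈_ = _≡_ ; _+_ = _xor_ ; _*_ = _∧_ ; -_ = λ x → x
                ; 0# = false ; 1# = true }

    ⟦_⟧₂ : Bool → Carrier
    ⟦ false ⟧₂ = 0#
    ⟦ true  ⟧₂ = 1#

    morphism : 𝔽₂ -Raw-AlmostCommutative⟶ fromCommutativeRing commutativeRing
    morphism = record
      { ⟦_⟧    = ⟦_⟧₂
      ; +-homo = λ { false _ → sym (+-identityˡ _) ; true false → sym (+-identityʳ _)
                   ; true true → sym 1+1≡0 }
      ; *-homo = λ { false _ → sym (zeroˡ _) ; true _ → sym (*-identityˡ _) }
      ; -‿homo = λ x → sym (-x≡x ⟦ x ⟧₂)
      ; 0-homo = refl
      ; 1-homo = refl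
      }

    _coeff≟_ : ∀ a b → Maybe (⟦ a ⟧₂ ≡ ⟦ b ⟧₂)
    false coeff≟ false = just refl
    true  coeff≟ true  = just refl
    _     coeff≟ _     = nothing

    open Algebra.Solver.Ring 𝔽₂ (fromCommutativeRing commutativeRing) morphism _coeff≟_ public

  open Solver using (solve; _:=_; _:+_; _:*_; con)

  +≡0⇒≡ : ∀ {x y} → x + y ≡ 0# → x ≡ y
  +≡0⇒≡ {x} {y} eq = +-cancelʳ y x y (trans eq (sym (x+x≡0 y)))

  ≡⇒+≡0 : ∀ {x y} → x ≡ y → x + y ≡ 0#
  ≡⇒+≡0 {x} refl = x+x≡0 x

  ≢⇒+≢0 : ∀ {x y} → x ≢ y → x + y ≢ 0#
  ≢⇒+≢0 x≢y eq = x≢y (+≡0⇒≡ eq)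

  ^-homo-* : ∀ x k n → x ^ (k ℕ.+ n) ≡ x ^ k * x ^ n
  ^-homo-* x zero    n = sym (*-identityˡ (x ^ n))
  ^-homo-* x (suc k) n = trans (cong (x *_) (^-homo-* x k n)) (sym (*-assoc x (x ^ k) (x ^ n)))

  ^-assocʳ : ∀ x k n → (x ^ k) ^ n ≡ x ^ (n ℕ.* k)
  ^-assocʳ x k zero    = refl
  ^-assocʳ x k (suc n) = trans (cong (x ^ k *_) (^-assocʳ x k n)) (sym (^-homo-* x k (n ℕ.* k)))

  ^-distrib-* : ∀ x y n → (x * y) ^ n ≡ x ^ n * y ^ n
  ^-distrib-* x y zero    = sym (*-identityˡ 1#)
  ^-distrib-* x y (suc n) = trans (cong ((x * y) *_) (^-distrib-* x y n))
    (solve 4 (λ a b c d → (a :* b) :* (c :* d) := (a :* c) :* (b :* d)) refl x y (x ^ n) (y ^ n))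

  1^n≡1 : ∀ n → 1# ^ n ≡ 1#
  1^n≡1 zero    = refl
  1^n≡1 (suc n) = trans (*-identityˡ _) (1^n≡1 n)

  ^2 : ∀ x → x ^ 2 ≡ x * x
  ^2 x = cong (x *_) (*-identityʳ x)

  frobenius : ∀ n x y → (x + y) ^ (2 ℕ.^ n) ≡ x ^ (2 ℕ.^ n) + y ^ (2 ℕ.^ n)
  frobenius zero    x y = distribʳ 1# x y
  frobenius (suc n) x y = begin
    (x + y) ^ (2 ℕ.* 2 ℕ.^ n)          ≡⟨ ^-assocʳ (x + y) (2 ℕ.^ n) 2 ⟨
    ((x + y) ^ (2 ℕ.^ n)) ^ 2          ≡⟨ cong (_^ 2) (frobenius n x y) ⟩
    (x ^ (2 ℕ.^ n) + y ^ (2 ℕ.^ n)) ^ 2 ≡⟨ ^2 _ ⟩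
    (u + v) * (u + v)                  ≡⟨ solve 2 (λ a b → (a :+ b) :* (a :+ b) := a :* a :+ b :* b) refl u v ⟩
    u * u + v * v                      ≡⟨ cong₂ _+_ (^2 u) (^2 v) ⟨
    u ^ 2 + v ^ 2                      ≡⟨ cong₂ _+_ (^-assocʳ x (2 ℕ.^ n) 2) (^-assocʳ y (2 ℕ.^ n) 2) ⟩
    x ^ (2 ℕ.* 2 ℕ.^ n) + y ^ (2 ℕ.* 2 ℕ.^ n) ∎
    where
    open ≡-Reasoning
    u = x ^ (2 ℕ.^ n)
    v = y ^ (2 ℕ.^ n)

  -- For nonzero x, multiplication by x permutes `elems` and fixes 0, so it permutes the nonzero
  -- elements `nz`. Cancelling their product gives exponent |nz| the value 1, and the removed 0
  -- accounts for one more factor x.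
  fermat : ∀ x → x ^ (q ℕ.* q) ≡ x
  fermat x with as , bs , eq ← ∈-∃++ (complete 0#) with x ≟ 0#
  -- As 0 itself occurs in `elems`, the exponent is a successor, so the power really has a factor 0.
  ... | yes refl = subst (λ n → 0# ^ n ≡ 0#) (trans (sym (↭-length elems↭)) order) (zeroˡ _)
    where
    elems↭ : elems ↭ 0# ∷ (as List.++ bs)
    elems↭ = subst (_↭ 0# ∷ (as List.++ bs)) (sym eq) (shift 0# as bs)
  ... | no x≢0 = subst (λ n → x ^ n ≡ x) (trans (sym (↭-length elems↭)) order)
                   (trans (cong (x *_) x^|nz|≡1) (*-identityʳ x))
    where
    open ≡-Reasoning
    nz = as List.++ bs
    elems↭ : elems ↭ 0# ∷ nz
    elems↭ = subst (_↭ 0# ∷ nz) (sym eq) (shift 0# as bs)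
    nz≢0 : ∀ {y} → y ∈ nz → y ≢ 0#
    nz≢0 {y} y∈ y≡0 with d ∷ _ ← Permutationₛ.Unique-resp-↭ (setoid Carrier) (↭⇒↭ₛ elems↭) unique = All.lookup d y∈ (sym y≡0)
    scale : map (x *_) nz ↭ nz
    scale = drop-∷ (↭-trans (subst (_↭ map (x *_) elems) (cong (_∷ map (x *_) nz) (zeroʳ x)) (map⁺ (x *_) (↭-sym elems↭)))
      (↭-trans (elems-map-↭ (x *_) (x ⁻¹ *_) (undo (*-inverseʳ x≢0)) (undo (*-inverseˡ x≢0))) elems↭))
      where
      undo : ∀ {a b} → a * b ≡ 1# → ∀ y → a * (b * y) ≡ y
      undo {a} {b} ab≡1 y = trans (sym (*-assoc a b y)) (trans (cong (_* y) ab≡1) (*-identityˡ y))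
    product≢0 : ∀ ys → (∀ {y} → y ∈ ys → y ≢ 0#) → foldr _*_ 1# ys ≢ 0#
    product≢0 []       _  eq = 0≢1 (sym eq)
    product≢0 (y ∷ ys) ne = *≢0 (ne (here refl)) (product≢0 ys (λ p → ne (there p)))
    power≡^ : ∀ n → Π.power x n ≡ x ^ n
    power≡^ zero    = refl
    power≡^ (suc n) = cong (x *_) (power≡^ n)
    x^|nz|≡1 : x ^ length nz ≡ 1#
    x^|nz|≡1 = *-cancelˡ (product≢0 nz nz≢0) (begin
      P * x ^ length nz          ≡⟨ *-comm P _ ⟩
      x ^ length nz * P          ≡⟨ cong (_* P) (power≡^ (length nz)) ⟨
      Π.power x (length nz) * P  ≡⟨ Π.foldr-translate x nz ⟨
      foldr _*_ 1# (map (x *_) nz) ≡⟨ Π.foldr-↭ scale ⟩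
      P                          ≡⟨ *-identityʳ P ⟨
      P * 1#                     ∎)
      where P = foldr _*_ 1# nz

-- Conjugation, trace, norm and the anisotropic form

module Unital {m : ℕ} (F : FiniteField m) where
  open FiniteField F
  open FieldProperties F
  open Solver using (solve; _:=_; _:+_; _:*_; :-_; con)

  -- In characteristic 2 an equation a ≡ b follows from hypotheses lᵢ ≡ rᵢ as soon as
  -- a + b is a linear combination of the lᵢ + rᵢ.
  by : ∀ {a b s} → a + b ≡ s → s ≡ 0# → a ≡ b
  by eq s≡0 = +≡0⇒≡ (trans eq s≡0)

  infixl 6 _⊕_
  infixl 7 _⊛_

  _⊕_ : ∀ {s t} → s ≡ 0# → t ≡ 0# → s + t ≡ 0#
  _⊕_ refl refl = +-identityˡ 0#

  _⊛_ : ∀ c {l r} → l ≡ r → c * (l + r) ≡ 0#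
  _⊛_ c {l} refl = trans (cong (c *_) (x+x≡0 l)) (zeroʳ c)

  conj : Carrier → Carrier
  conj x = x ^ q

  conj-+ : ∀ x y → conj (x + y) ≡ conj x + conj y
  conj-+ = frobenius m

  conj-* : ∀ x y → conj (x * y) ≡ conj x * conj y
  conj-* x y = ^-distrib-* x y q

  conj-1 : conj 1# ≡ 1#
  conj-1 = 1^n≡1 q

  conj-0 : conj 0# ≡ 0#
  conj-0 = trans (cong conj (sym (x+x≡0 0#))) (trans (conj-+ 0# 0#) (x+x≡0 (conj 0#)))

  conj-involutive : ∀ x → conj (conj x) ≡ x
  conj-involutive x = trans (^-assocʳ x q q) (fermat x)

  conj≢0 : ∀ {x} → x ≢ 0# → conj x ≢ 0#
  conj≢0 {x} x≢0 eq = x≢0 (trans (sym (conj-involutive x)) (trans (cong conj eq) conj-0))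

  conj-inverse : ∀ {x y} → x * y ≡ 1# → conj x * conj y ≡ 1#
  conj-inverse {x} {y} eq = trans (sym (conj-* x y)) (trans (cong conj eq) conj-1)

  T N : Carrier → Carrier
  T x = x + conj x
  N x = x * conj x

  T-+ : ∀ x y → T (x + y) ≡ T x + T y
  T-+ x y = trans (cong ((x + y) +_) (conj-+ x y))
    (solve 4 (λ a b c d → (a :+ b) :+ (c :+ d) := (a :+ c) :+ (b :+ d)) refl x y (conj x) (conj y))

  T-* : ∀ {r} → conj r ≡ r → ∀ x → T (r * x) ≡ r * T x
  T-* {r} r∈Fq x = trans (cong (r * x +_) (trans (conj-* r x) (cong (_* conj x) r∈Fq)))
                        (sym (distribˡ r x (conj x)))

  T-0 : ∀ {x} → conj x ≡ x → T x ≡ 0#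
  T-0 {x} eq = trans (cong (x +_) eq) (x+x≡0 x)

  T≡0⇒ : ∀ {x} → T x ≡ 0# → conj x ≡ x
  T≡0⇒ eq = sym (+≡0⇒≡ eq)

  conj-T : ∀ x → conj (T x) ≡ T x
  conj-T x = trans (conj-+ x (conj x)) (trans (cong (conj x +_) (conj-involutive x)) (+-comm (conj x) x))

  conj-N : ∀ x → conj (N x) ≡ N x
  conj-N x = trans (conj-* x (conj x)) (trans (cong (conj x *_) (conj-involutive x)) (*-comm (conj x) x))

  conj-⁻¹ : ∀ {x} → x ≢ 0# → conj x ≡ x → conj (x ⁻¹) ≡ x ⁻¹
  conj-⁻¹ {x} x≢0 eq = *-cancelˡ x≢0 (trans (cong (_* conj (x ⁻¹)) (sym eq))
    (trans (conj-inverse (*-inverseʳ x≢0)) (sym (*-inverseʳ x≢0))))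

  ^[q+1] : ∀ x → x ^ (q ℕ.+ 1) ≡ N x
  ^[q+1] x = trans (^-homo-* x q 1) (trans (cong (conj x *_) (*-identityʳ x)) (*-comm (conj x) x))

  -- The i-th summand is v^(2^(i+1)) + v^(2^i). The function `f` is the shift by k that arises when
  -- `upTo` is unfolded one index at a time.
  trace-telescope : ∀ v n k (f : ℕ → ℕ) → (∀ i → f i ≡ i ℕ.+ k) →
    foldr (λ i s → (v * v + v) ^ (2 ℕ.^ i) + s) 0# (applyUpTo f n)
      ≡ v ^ (2 ℕ.^ (n ℕ.+ k)) + v ^ (2 ℕ.^ k)
  trace-telescope v zero    k f eq = sym (x+x≡0 _)
  trace-telescope v (suc n) k f eq = begin
    (v * v + v) ^ (2 ℕ.^ f 0) + rest         ≡⟨ cong₂ _+_ (trans (cong (λ i → (v * v + v) ^ (2 ℕ.^ i)) (eq 0)) step) IH ⟩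
    (v ^ (2 ℕ.^ suc k) + v ^ (2 ℕ.^ k)) + (v ^ (2 ℕ.^ (n ℕ.+ suc k)) + v ^ (2 ℕ.^ suc k))
      ≡⟨ solve 3 (λ a b c → (a :+ b) :+ (c :+ a) := c :+ b) refl _ _ _ ⟩
    v ^ (2 ℕ.^ (n ℕ.+ suc k)) + v ^ (2 ℕ.^ k) ≡⟨ cong (λ i → v ^ (2 ℕ.^ i) + v ^ (2 ℕ.^ k)) (ℕₚ.+-suc n k) ⟩
    v ^ (2 ℕ.^ suc (n ℕ.+ k)) + v ^ (2 ℕ.^ k) ∎
    where
    open ≡-Reasoning
    rest = foldr (λ i s → (v * v + v) ^ (2 ℕ.^ i) + s) 0# (applyUpTo (f ∘ suc) n)
    IH = trace-telescope v n (suc k) (f ∘ suc) (λ i → trans (eq (suc i)) (sym (ℕₚ.+-suc i k)))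
    step : (v * v + v) ^ (2 ℕ.^ k) ≡ v ^ (2 ℕ.^ suc k) + v ^ (2 ℕ.^ k)
    step = trans (frobenius k (v * v) v) (cong (_+ v ^ (2 ℕ.^ k))
      (trans (^-distrib-* v v (2 ℕ.^ k)) (trans (sym (^2 (v ^ (2 ℕ.^ k)))) (^-assocʳ v (2 ℕ.^ k) 2))))

  -- The absolute trace has only m terms, so for v in the larger field the sum ends at v^q instead
  -- of returning to v. It therefore detects whether v lies in 𝔽_q.
  trace-[v²+v] : ∀ v → trace (v * v + v) ≡ T v
  trace-[v²+v] v = trans (trace-telescope v m 0 id (λ i → sym (ℕₚ.+-identityʳ i)))
    (trans (cong₂ _+_ (cong (λ i → v ^ (2 ℕ.^ i)) (ℕₚ.+-identityʳ m)) (*-identityʳ v)) (+-comm (conj v) v))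

  -- The affine points (x, y) of 𝒰_{1,b} are those with T y = Q β x for β = b + b^q.
  Q : Carrier → Carrier → Carrier
  Q β x = T x * T x + β * N x

  module Anisotropy (b : Carrier) (bm : IsOrthogonalBM 1# b) where

    β : Carrier
    β = T b

    β≢0 : β ≢ 0#
    β≢0 eq = proj₁ bm (T≡0⇒ eq)

    -- An isotropic x would make w = x / T x a root of X² + X = 1/β with T w = 1,
    -- and then d = 1/β² = w⁴ + w² would have absolute trace T (w²) = 1.
    Q≡0⇒≡0 : ∀ {x} → Q β x ≡ 0# → x ≡ 0#
    Q≡0⇒≡0 {x} Qx≡0 with x ≟ 0#
    ... | yes x≡0 = x≡0
    ... | no  x≢0 = contradiction (trans (sym (proj₂ bm d dβ²)) trace-d) 0≢1
      where
      t  = T x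
      x̄  = conj x
      t²≡βN : t * t ≡ β * N x
      t²≡βN = +≡0⇒≡ Qx≡0
      t≢0 : t ≢ 0#
      t≢0 t≡0 = *≢0 β≢0 (*≢0 x≢0 (conj≢0 x≢0))
                  (trans (sym t²≡βN) (trans (cong (_* t) t≡0) (zeroˡ t)))
      i = t ⁻¹
      it≡1 : i * t ≡ 1#
      it≡1 = *-inverseˡ t≢0
      w  = i * x
      v  = w * w
      d  = v * v + v
      Tw≡1 : T w ≡ 1#
      Tw≡1 = trans (T-* (conj-⁻¹ t≢0 (conj-T x)) x) it≡1
      -- Since T w = 1, the conjugate of w is w + 1, whence w² + w = N(w) = N(x)/t² = 1/β.
      βd₀≡1 : β * (w * w + w) ≡ 1#
      βd₀≡1 = by (solve 4 (λ β x x̄ i →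
           let t = x :+ x̄ ; w = i :* x in
           β :* (w :* w :+ w) :+ con true
           := (i :* i) :* (t :* t :+ β :* (x :* x̄)) :+ (i :* t :+ con true) :* (i :* t :+ con true) :+ β :* i :* x :* (i :* t :+ con true)) refl β x x̄ i)
         (i * i ⊛ t²≡βN ⊕ (trans (cong (_* (i * t + 1#)) (≡⇒+≡0 it≡1)) (zeroˡ _)) ⊕ (β * i * x ⊛ it≡1))
      dβ² : d * ((b ^ q + b) ^ 2) ≡ 1# ^ (q ℕ.+ 1)
      dβ² = begin
        d * ((b ^ q + b) ^ 2)  ≡⟨ cong (d *_) (^2 _) ⟩
        d * ((b ^ q + b) * (b ^ q + b))
          ≡⟨ solve 3 (λ w b b̄ → let v = w :* w in (v :* v :+ v) :* ((b̄ :+ b) :* (b̄ :+ b))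
                := ((b :+ b̄) :* (v :+ w)) :* ((b :+ b̄) :* (v :+ w))) refl w b (conj b) ⟩
        (β * (w * w + w)) * (β * (w * w + w)) ≡⟨ cong₂ _*_ βd₀≡1 βd₀≡1 ⟩
        1# * 1#                ≡⟨ *-identityʳ 1# ⟩
        1#                     ≡⟨ 1^n≡1 (q ℕ.+ 1) ⟨
        1# ^ (q ℕ.+ 1)         ∎
        where open ≡-Reasoning
      trace-d : trace d ≡ 1#
      trace-d = trans (trace-[v²+v] v) (trans (cong (v +_) (conj-* w w))
        (trans (solve 2 (λ w w̄ → w :* w :+ w̄ :* w̄ := (w :+ w̄) :* (w :+ w̄)) refl w (conj w))
               (trans (cong₂ _*_ Tw≡1 Tw≡1) (*-identityʳ 1#))))

    -- For λ ∈ 𝔽_q the defect of Q from being affine on the line through c and c + z is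
    -- (λ² + λ) Q(z), so no further point of a secant has its parameter λ in 𝔽_q.
    Fq-ratio : ∀ {c z r y₀ y₁ y₂} → conj r ≡ r → z ≢ 0# →
               T y₀ ≡ Q β c → T y₁ ≡ Q β (r * z + c) → T y₂ ≡ Q β (z + c) →
               y₁ + y₀ ≡ r * (y₂ + y₀) → r ≢ 0# → r ≡ 1#
    Fq-ratio {c} {z} {r} {y₀} {y₁} {y₂} r∈Fq z≢0 E₀ E₁ E₂ L r≢0 =
      +≡0⇒≡ (*-zero-cancel r≢0 (*-zero-cancel (λ eq → z≢0 (Q≡0⇒≡0 eq)) key))
      where
      z̄ = conj z
      c̄ = conj c
      E₁′ : T y₁ ≡ (r * z + c + (r * z̄ + c̄)) * (r * z + c + (r * z̄ + c̄)) + β * ((r * z + c) * (r * z̄ + c̄))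
      E₁′ = trans E₁ (cong (λ u → (r * z + c + u) * (r * z + c + u) + β * ((r * z + c) * u))
              (trans (conj-+ (r * z) c) (cong (_+ c̄) (trans (conj-* r z) (cong (_* z̄) r∈Fq)))))
      E₂′ : T y₂ ≡ (z + c + (z̄ + c̄)) * (z + c + (z̄ + c̄)) + β * ((z + c) * (z̄ + c̄))
      E₂′ = trans E₂ (cong (λ u → (z + c + u) * (z + c + u) + β * ((z + c) * u)) (conj-+ z c))
      TL : T y₁ + T y₀ ≡ r * (T y₂ + T y₀)
      TL = trans (sym (T-+ y₁ y₀)) (trans (cong T L) (trans (T-* r∈Fq (y₂ + y₀)) (cong (r *_) (T-+ y₂ y₀))))
      key : Q β z * (r * (r + 1#)) ≡ 0#
      key = by {s = 1# * (T y₁ + T y₀ + r * (T y₂ + T y₀)) + 1# * (T y₁ + Q₁) + (1# + r) * (T y₀ + Q β c) + r * (T y₂ + Q₂)}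
        (solve 9 (λ β z z̄ c c̄ r t₀ t₁ t₂ →
           let Q = λ x x̄ → (x :+ x̄) :* (x :+ x̄) :+ β :* (x :* x̄) in
           Q z z̄ :* (r :* (r :+ con true)) :+ con false
           := con true :* (t₁ :+ t₀ :+ r :* (t₂ :+ t₀)) :+ con true :* (t₁ :+ Q (r :* z :+ c) (r :* z̄ :+ c̄))
              :+ (con true :+ r) :* (t₀ :+ Q c c̄) :+ r :* (t₂ :+ Q (z :+ c) (z̄ :+ c̄)))
           refl β z z̄ c c̄ r (T y₀) (T y₁) (T y₂))
        (1# ⊛ TL ⊕ 1# ⊛ E₁′ ⊕ (1# + r) ⊛ E₀ ⊕ r ⊛ E₂′)
        where
        Q₁ = (r * z + c + (r * z̄ + c̄)) * (r * z + c + (r * z̄ + c̄)) + β * ((r * z + c) * (r * z̄ + c̄))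
        Q₂ = (z + c + (z̄ + c̄)) * (z + c + (z̄ + c̄)) + β * ((z + c) * (z̄ + c̄))

-- Collinear affine points of the unital

module Configurations {m : ℕ} (F : FiniteField m)
  (b : FiniteField.Carrier F) (bm : FiniteField.IsOrthogonalBM F (FiniteField.1# F) b) where
  open FiniteField F
  open FieldProperties F
  open Unital F
  open Anisotropy b bm
  open Solver using (solve; _:=_; _:+_; _:*_; con)

  OnUnital : Carrier × Carrier → Set
  OnUnital (x , y) = T y ≡ Q β x

  -- Equality of slopes at P₁, multiplied out so that vertical lines are covered. Exchanging P₂ and
  -- P₃ exchanges the two sides, so `sym` performs that swap.
  Collinear : (P₁ P₂ P₃ : Carrier × Carrier) → Set
  Collinear (x₁ , y₁) (x₂ , y₂) (x₃ , y₃) = (y₂ + y₁) * (x₃ + x₁) ≡ (y₃ + y₁) * (x₂ + x₁)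

  sameColumn-∈Fq : ∀ {x y y′} → OnUnital (x , y) → OnUnital (x , y′) → conj (y + y′) ≡ y + y′
  sameColumn-∈Fq {y = y} {y′} E E′ = T≡0⇒ (trans (T-+ y y′) (≡⇒+≡0 (trans E (sym E′))))

  -- If the trace vanished, r = z₁/z₂ would lie in 𝔽_q and be the parameter of the first point on
  -- the secant from (c, d) to the second; `Fq-ratio` then forces r = 1. So z₁ and z₂ are
  -- independent over 𝔽_q.
  T-z₁z̄₂≢0 : ∀ {c d x₁ y₁ x₂ y₂} → OnUnital (c , d) → OnUnital (x₁ , y₁) → OnUnital (x₂ , y₂) →
             Collinear (c , d) (x₁ , y₁) (x₂ , y₂) → x₁ ≢ c → x₂ ≢ c → x₁ ≢ x₂ →
             T ((x₁ + c) * conj (x₂ + c)) ≢ 0#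
  T-z₁z̄₂≢0 {c} {d} {x₁} {y₁} {x₂} {y₂} E₀ E₁ E₂ L x₁≢c x₂≢c x₁≢x₂ Tz≡0 = x₁≢x₂ x₁≡x₂
    where
    z₁ = x₁ + c
    z₂ = x₂ + c
    z₂≢0 = ≢⇒+≢0 x₂≢c
    u = z₂ ⁻¹
    uz≡1 : u * z₂ ≡ 1#
    uz≡1 = *-inverseˡ z₂≢0
    ūz̄≡1 : conj u * conj z₂ ≡ 1#
    ūz̄≡1 = conj-inverse uz≡1
    r = z₁ * u
    z₁z̄₂ : z₁ * conj z₂ ≡ conj z₁ * z₂
    z₁z̄₂ = trans (+≡0⇒≡ Tz≡0) (trans (conj-* z₁ (conj z₂)) (cong (conj z₁ *_) (conj-involutive z₂)))
    r∈Fq : conj r ≡ r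
    r∈Fq = trans (conj-* z₁ u) (by
      (solve 6 (λ z₁ z̄₁ z₂ z̄₂ u ū → z̄₁ :* ū :+ z₁ :* u
        := u :* ū :* (z₁ :* z̄₂ :+ z̄₁ :* z₂) :+ z̄₁ :* ū :* (u :* z₂ :+ con true) :+ z₁ :* u :* (ū :* z̄₂ :+ con true))
        refl z₁ (conj z₁) z₂ (conj z₂) u (conj u))
      (u * conj u ⊛ z₁z̄₂ ⊕ conj z₁ * conj u ⊛ uz≡1 ⊕ z₁ * u ⊛ ūz̄≡1))
    r*z₂ : r * z₂ + c ≡ x₁
    r*z₂ = by (solve 4 (λ x₁ c z₂ u → (x₁ :+ c) :* u :* z₂ :+ c :+ x₁ := (x₁ :+ c) :* (u :* z₂ :+ con true))
      refl x₁ c z₂ u) (z₁ ⊛ uz≡1)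
    z₂+c : z₂ + c ≡ x₂
    z₂+c = solve 2 (λ x c → x :+ c :+ c := x) refl x₂ c
    L′ : y₁ + d ≡ r * (y₂ + d)
    L′ = by (solve 5 (λ Y₁ Y₂ z₁ z₂ u → Y₁ :+ z₁ :* u :* Y₂
         := u :* (Y₁ :* z₂ :+ Y₂ :* z₁) :+ Y₁ :* (u :* z₂ :+ con true)) refl (y₁ + d) (y₂ + d) z₁ z₂ u)
      (u ⊛ L ⊕ (y₁ + d) ⊛ uz≡1)
    r≢0 : r ≢ 0#
    r≢0 eq = x₁≢c (trans (sym r*z₂) (trans (cong (λ t → t * z₂ + c) eq)
               (trans (cong (_+ c) (zeroˡ z₂)) (+-identityˡ c))))
    r≡1 : r ≡ 1#
    r≡1 = Fq-ratio r∈Fq z₂≢0 E₀ (trans E₁ (cong (Q β) (sym r*z₂))) (trans E₂ (cong (Q β) (sym z₂+c))) L′ r≢0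
    x₁≡x₂ : x₁ ≡ x₂
    x₁≡x₂ = trans (sym r*z₂) (trans (cong (λ t → t * z₂ + c) r≡1) (trans (cong (_+ c) (*-identityˡ z₂)) z₂+c))

  -- The points would lie in pairs on the columns a, e, g through `T∞`. Adding the equations of
  -- AB′C′ and A′BC′ cancels C′ and gives (g + a)/(e + a) = r/(r + s), where r and s are differences
  -- within a column and hence in 𝔽_q. The secant ABC then contradicts `Fq-ratio`.
  no-quadrangle-T∞ : ∀ {a e g yA yA′ yB yB′ yC yC′} →
    OnUnital (a , yA) → OnUnital (a , yA′) → OnUnital (e , yB) → OnUnital (e , yB′) → OnUnital (g , yC) →
    yA ≢ yA′ → a ≢ e → a ≢ g → e ≢ g →
    Collinear (a , yA) (e , yB) (g , yC) → Collinear (a , yA) (e , yB′) (g , yC′) →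
    ¬ Collinear (a , yA′) (e , yB) (g , yC′)
  no-quadrangle-T∞ {a} {e} {g} {yA} {yA′} {yB} {yB′} {yC} {yC′} EA EA′ EB EB′ EC yA≢ a≢e a≢g e≢g L₁ L₂ L₃ =
    e≢g (sym (trans (sym wz+a) (trans (cong (λ t → t * z + a) w≡1) (trans (cong (_+ a) (*-identityˡ z)) z+a))))
    where
    z = e + a
    z≢0 : z ≢ 0#
    z≢0 = ≢⇒+≢0 (λ eq → a≢e (sym eq))
    u = z ⁻¹
    uz≡1 : u * z ≡ 1#
    uz≡1 = *-inverseˡ z≢0
    w = (g + a) * u
    r = yA + yA′
    s = yB + yB′
    r≢0 : r ≢ 0#
    r≢0 = ≢⇒+≢0 yA≢
    w[r+s]≡r : w * (r + s) ≡ r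
    w[r+s]≡r = by
      (solve 9 (λ a e g u yA yA′ yB yB′ yC′ →
         let z = e :+ a ; r = yA :+ yA′ ; s = yB :+ yB′ in
         (g :+ a) :* u :* (r :+ s) :+ r
         := u :* ((yB′ :+ yA) :* (g :+ a) :+ (yC′ :+ yA) :* z)
            :+ u :* ((yB :+ yA′) :* (g :+ a) :+ (yC′ :+ yA′) :* z)
            :+ r :* (u :* z :+ con true)) refl a e g u yA yA′ yB yB′ yC′)
      (u ⊛ L₂ ⊕ u ⊛ L₃ ⊕ r ⊛ uz≡1)
    r+s≢0 : r + s ≢ 0#
    r+s≢0 eq = r≢0 (trans (sym w[r+s]≡r) (trans (cong (w *_) eq) (zeroʳ w)))
    conj-r+s : conj (r + s) ≡ r + s
    conj-r+s = trans (conj-+ r s) (cong₂ _+_ (sameColumn-∈Fq EA EA′) (sameColumn-∈Fq EB EB′))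
    w∈Fq : conj w ≡ w
    w∈Fq = *-cancelˡ r+s≢0 (begin
      (r + s) * conj w        ≡⟨ *-comm (r + s) (conj w) ⟩
      conj w * (r + s)        ≡⟨ cong (conj w *_) conj-r+s ⟨
      conj w * conj (r + s)   ≡⟨ conj-* w (r + s) ⟨
      conj (w * (r + s))      ≡⟨ cong conj w[r+s]≡r ⟩
      conj r                  ≡⟨ sameColumn-∈Fq EA EA′ ⟩
      r                       ≡⟨ w[r+s]≡r ⟨
      w * (r + s)             ≡⟨ *-comm w (r + s) ⟩
      (r + s) * w             ∎)
      where open ≡-Reasoning
    wz+a : w * z + a ≡ g
    wz+a = by (solve 4 (λ g a z u → (g :+ a) :* u :* z :+ a :+ g := (g :+ a) :* (u :* z :+ con true)) refl g a z u)
      ((g + a) ⊛ uz≡1)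
    z+a : z + a ≡ e
    z+a = solve 2 (λ x c → x :+ c :+ c := x) refl e a
    w≢0 : w ≢ 0#
    w≢0 eq = a≢g (sym (trans (sym wz+a) (trans (cong (λ t → t * z + a) eq)
               (trans (cong (_+ a) (zeroˡ z)) (+-identityˡ a)))))
    L′ : yC + yA ≡ w * (yB + yA)
    L′ = by (solve 5 (λ Y₁ Y₂ z₁ z₂ u → Y₁ :+ z₁ :* u :* Y₂
         := u :* (Y₂ :* z₁ :+ Y₁ :* z₂) :+ Y₁ :* (u :* z₂ :+ con true)) refl (yC + yA) (yB + yA) (g + a) z u)
      (u ⊛ L₁ ⊕ (yC + yA) ⊛ uz≡1)
    w≡1 : w ≡ 1#
    w≡1 = Fq-ratio w∈Fq z≢0 EA (trans EC (cong (Q β) (sym wz+a))) (trans EB (cong (Q β) (sym z+a))) L′ w≢0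

  -- Five of the six sides of the quadrangle P₁P₂P₃P₄ are enough: in terms of uⱼ = 1/(xⱼ + c) the incidences
  -- of its sides with the diagonal points (c , dᵢ) force the uⱼ onto a line of AG(2,q) which misses 0, that is
  -- T (k * conj uⱼ) = 1 for some k, and h = conj c + k.
  quadrangle : ∀ {c d₀ d₁ d₂ x₁ y₁ x₂ y₂ x₃ y₃ x₄ y₄} →
    OnUnital (c , d₀) → OnUnital (c , d₁) → OnUnital (c , d₂) → OnUnital (x₁ , y₁) → OnUnital (x₂ , y₂) →
    d₀ ≢ d₁ → d₁ ≢ d₂ → x₁ ≢ c → x₂ ≢ c → x₃ ≢ c → x₄ ≢ c → x₁ ≢ x₂ →
    Collinear (c , d₀) (x₁ , y₁) (x₂ , y₂) → Collinear (c , d₀) (x₃ , y₃) (x₄ , y₄) →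
    Collinear (c , d₁) (x₁ , y₁) (x₃ , y₃) → Collinear (c , d₁) (x₂ , y₂) (x₄ , y₄) →
    Collinear (c , d₂) (x₂ , y₂) (x₃ , y₃) →
    ∃ λ h → T (h * (x₁ + c)) ≡ N x₁ + N c × T (h * (x₂ + c)) ≡ N x₂ + N c ×
            T (h * (x₃ + c)) ≡ N x₃ + N c × T (h * (x₄ + c)) ≡ N x₄ + N c
  quadrangle {c} {d₀} {d₁} {d₂} {x₁} {y₁} {x₂} {y₂} {x₃} {y₃} {x₄} {y₄}
    E₀ E₁ E₂ F₁ F₂ d₀≢d₁ d₁≢d₂ x₁≢c x₂≢c x₃≢c x₄≢c x₁≢x₂ L₁₂ L₃₄ L₁₃ L₂₄ L₂₃ =
    conj c + k , lift x₁≢c Tku₁ , lift x₂≢c (on-line u₂≡ 1∈Fq) ,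
    lift x₃≢c (on-line u₃≡ ρ∈Fq) , lift x₄≢c (on-line u₄≡′ 1+ρ∈Fq)
    where
    inv : Carrier → Carrier
    inv x = (x + c) ⁻¹
    inv-eq : ∀ {x} → x ≢ c → inv x * (x + c) ≡ 1#
    inv-eq x≢c = *-inverseˡ (≢⇒+≢0 x≢c)
    u₁ = inv x₁
    u₂ = inv x₂
    u₃ = inv x₃
    u₄ = inv x₄
    e = u₁ + u₂
    f = u₁ + u₃
    1∈Fq = conj-1

    -- `(y + d) * inv x` is the slope of the line joining (c, d) to (x, y), so collinearity becomes
    -- linear in the inverses.
    divided : ∀ {d x y x′ y′} → x ≢ c → x′ ≢ c → Collinear (c , d) (x , y) (x′ , y′) →
              (y + d) * inv x ≡ (y′ + d) * inv x′
    divided {d} {x} {y} {x′} {y′} x≢c x′≢c L = by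
      (solve 6 (λ Y Y′ z z′ u u′ → Y :* u :+ Y′ :* u′
        := u :* u′ :* (Y :* z′ :+ Y′ :* z) :+ Y :* u :* (u′ :* z′ :+ con true) :+ Y′ :* u′ :* (u :* z :+ con true))
        refl (y + d) (y′ + d) (x + c) (x′ + c) (inv x) (inv x′))
      (inv x * inv x′ ⊛ L ⊕ (y + d) * inv x ⊛ inv-eq x′≢c ⊕ (y′ + d) * inv x′ ⊛ inv-eq x≢c)

    M₁₂ = divided x₁≢c x₂≢c L₁₂
    M₃₄ = divided x₃≢c x₄≢c L₃₄
    M₁₃ = divided x₁≢c x₃≢c L₁₃
    M₂₄ = divided x₂≢c x₄≢c L₂₄
    M₂₃ = divided x₂≢c x₃≢c L₂₃

    -- In the sum of the four slope equations at d₀ and d₁ every term yⱼuⱼ occurs twice, leaving (d₀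
    -- + d₁)(u₁ + u₂ + u₃ + u₄) = 0.
    u₄≡ : u₄ ≡ u₁ + (e + f)
    u₄≡ = by {s = u₁ + u₂ + u₃ + u₄}
      (solve 4 (λ u₁ u₂ u₃ u₄ → u₄ :+ (u₁ :+ ((u₁ :+ u₂) :+ (u₁ :+ u₃))) := u₁ :+ u₂ :+ u₃ :+ u₄)
        refl u₁ u₂ u₃ u₄)
      (*-zero-cancel (≢⇒+≢0 d₀≢d₁) (by
        (solve 10 (λ d₀ d₁ y₁ y₂ y₃ y₄ u₁ u₂ u₃ u₄ → (d₀ :+ d₁) :* (u₁ :+ u₂ :+ u₃ :+ u₄) :+ con false
          := con true :* ((y₁ :+ d₀) :* u₁ :+ (y₂ :+ d₀) :* u₂) :+ con true :* ((y₃ :+ d₀) :* u₃ :+ (y₄ :+ d₀) :* u₄)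
          :+ con true :* ((y₁ :+ d₁) :* u₁ :+ (y₃ :+ d₁) :* u₃) :+ con true :* ((y₂ :+ d₁) :* u₂ :+ (y₄ :+ d₁) :* u₄))
          refl d₀ d₁ y₁ y₂ y₃ y₄ u₁ u₂ u₃ u₄)
        (1# ⊛ M₁₂ ⊕ 1# ⊛ M₃₄ ⊕ 1# ⊛ M₁₃ ⊕ 1# ⊛ M₂₄)))

    d₁+d₂≢0 = ≢⇒+≢0 d₁≢d₂
    σ = (d₁ + d₂) ⁻¹
    ρ = σ * (d₀ + d₂)
    σ-eq : σ * (d₁ + d₂) ≡ 1#
    σ-eq = *-inverseˡ d₁+d₂≢0
    ρ∈Fq : conj ρ ≡ ρ
    ρ∈Fq = trans (conj-* σ (d₀ + d₂))
      (cong₂ _*_ (conj-⁻¹ d₁+d₂≢0 (sameColumn-∈Fq E₁ E₂)) (sameColumn-∈Fq E₀ E₂))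
    1+ρ∈Fq : conj (1# + ρ) ≡ 1# + ρ
    1+ρ∈Fq = trans (conj-+ 1# ρ) (cong₂ _+_ conj-1 ρ∈Fq)

    -- The sides of the triangle 1, 2, 3 add up to (d₀ + d₂) e + (d₁ + d₂) f = 0, again without the
    -- yⱼ. The coefficients are differences within the column c, so ρ is in 𝔽_q and the uⱼ lie on u₁
    -- + 𝔽_q e.
    f≡ρe : f ≡ ρ * e
    f≡ρe = by
      (solve 10 (λ d₀ d₁ d₂ y₁ y₂ y₃ u₁ u₂ u₃ σ →
         u₁ :+ u₃ :+ σ :* (d₀ :+ d₂) :* (u₁ :+ u₂)
         := (u₁ :+ u₃) :* (σ :* (d₁ :+ d₂) :+ con true)
            :+ σ :* ((y₁ :+ d₀) :* u₁ :+ (y₂ :+ d₀) :* u₂) :+ σ :* ((y₁ :+ d₁) :* u₁ :+ (y₃ :+ d₁) :* u₃)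
            :+ σ :* ((y₂ :+ d₂) :* u₂ :+ (y₃ :+ d₂) :* u₃))
         refl d₀ d₁ d₂ y₁ y₂ y₃ u₁ u₂ u₃ σ)
      ((u₁ + u₃) ⊛ σ-eq ⊕ σ ⊛ M₁₂ ⊕ σ ⊛ M₁₃ ⊕ σ ⊛ M₂₃)

    u₂≡ : u₂ ≡ u₁ + 1# * e
    u₂≡ = solve 2 (λ u₁ u₂ → u₂ := u₁ :+ con true :* (u₁ :+ u₂)) refl u₁ u₂
    u₃≡ : u₃ ≡ u₁ + ρ * e
    u₃≡ = trans (solve 2 (λ u₁ u₃ → u₃ := u₁ :+ (u₁ :+ u₃)) refl u₁ u₃) (cong (u₁ +_) f≡ρe)
    u₄≡′ : u₄ ≡ u₁ + (1# + ρ) * e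
    u₄≡′ = trans u₄≡ (cong (u₁ +_) (trans (cong (e +_) f≡ρe)
      (solve 2 (λ e ρ → e :+ ρ :* e := (con true :+ ρ) :* e) refl e ρ)))

    -- Up to a scalar, τ is the determinant of e and u₁ over 𝔽_q; it is nonzero exactly when they
    -- are independent. Dividing e by τ normalises the line to T(k ū) = 1, because T(e ē) = 0.
    τ : Carrier
    τ = T (e * conj u₁)
    τ≢0 : τ ≢ 0#
    -- T(u₁ū₁) = 0 reduces τ to T(u₂ū₁), and multiplying by N(z₁) N(z₂) turns this into T(z₁z̄₂).
    τ≢0 τ≡0 = T-z₁z̄₂≢0 E₀ F₁ F₂ L₁₂ x₁≢c x₂≢c x₁≢x₂ (trans
      (cong (z₁ * conj z₂ +_) (trans (conj-* z₁ (conj z₂)) (cong (conj z₁ *_) (conj-involutive z₂))))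
      (by (solve 8 (λ z₁ z̄₁ z₂ z̄₂ u₁ ū₁ u₂ ū₂ → z₁ :* z̄₂ :+ z̄₁ :* z₂ :+ con false
            := z₁ :* z̄₁ :* z₂ :* z̄₂ :* ((u₁ :+ u₂) :* ū₁ :+ (ū₁ :+ ū₂) :* u₁ :+ con false)
               :+ z₁ :* z̄₂ :* ū₁ :* z̄₁ :* (u₂ :* z₂ :+ con true) :+ z₁ :* z̄₂ :* (ū₁ :* z̄₁ :+ con true)
               :+ z̄₁ :* z₂ :* u₁ :* z₁ :* (ū₂ :* z̄₂ :+ con true) :+ z̄₁ :* z₂ :* (u₁ :* z₁ :+ con true))
            refl z₁ (conj z₁) z₂ (conj z₂) u₁ (conj u₁) u₂ (conj u₂))
          ((z₁ * conj z₁ * z₂ * conj z₂) ⊛ τ′ ⊕ z₁ * conj z₂ * conj u₁ * conj z₁ ⊛ inv-eq x₂≢c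
            ⊕ z₁ * conj z₂ ⊛ conj-inverse (inv-eq x₁≢c) ⊕ conj z₁ * z₂ * u₁ * z₁ ⊛ conj-inverse (inv-eq x₂≢c)
            ⊕ conj z₁ * z₂ ⊛ inv-eq x₁≢c)))
      where
      z₁ = x₁ + c
      z₂ = x₂ + c
      τ′ : (u₁ + u₂) * conj u₁ + (conj u₁ + conj u₂) * u₁ ≡ 0#
      τ′ = trans (cong ((u₁ + u₂) * conj u₁ +_) (sym (trans (conj-* e (conj u₁))
             (cong₂ _*_ (conj-+ u₁ u₂) (conj-involutive u₁))))) τ≡0
    τ∈Fq : conj (τ ⁻¹) ≡ τ ⁻¹
    τ∈Fq = conj-⁻¹ τ≢0 (conj-T (e * conj u₁))
    k = τ ⁻¹ * e

    Tku₁ : T (k * conj u₁) ≡ 1#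
    Tku₁ = trans (cong T (*-assoc (τ ⁻¹) e (conj u₁))) (trans (T-* τ∈Fq (e * conj u₁)) (*-inverseˡ τ≢0))

    on-line : ∀ {u r} → u ≡ u₁ + r * e → conj r ≡ r → T (k * conj u) ≡ 1#
    on-line {r = r} refl r∈Fq = begin
      T (k * conj (u₁ + r * e)) ≡⟨ cong (λ t → T (k * t)) (trans (conj-+ u₁ (r * e)) (cong (conj u₁ +_)
                                      (trans (conj-* r e) (cong (_* conj e) r∈Fq)))) ⟩
      T (k * (conj u₁ + r * conj e)) ≡⟨ cong T (solve 5 (λ i e ē u r → i :* e :* (u :+ r :* ē)
                                      := i :* e :* u :+ (i :* r) :* (e :* ē)) refl (τ ⁻¹) e (conj e) (conj u₁) r) ⟩
      T (k * conj u₁ + (τ ⁻¹ * r) * N e) ≡⟨ T-+ (k * conj u₁) ((τ ⁻¹ * r) * N e) ⟩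
      T (k * conj u₁) + T ((τ ⁻¹ * r) * N e) ≡⟨ cong₂ _+_ Tku₁ (T-0 (trans (conj-* (τ ⁻¹ * r) (N e))
                                      (cong₂ _*_ (trans (conj-* (τ ⁻¹) r) (cong₂ _*_ τ∈Fq r∈Fq)) (conj-N e)))) ⟩
      1# + 0#                 ≡⟨ +-identityʳ 1# ⟩
      1#                      ∎
      where open ≡-Reasoning

    -- For z = x + c one has N(x) + N(c) = N(z) + T(c̄ z), so the claim is T(k z) = N(z). This is
    -- quadratic in z, but division by N(z) makes it the linear condition T(k ū) = 1 on u = 1/z.
    lift : ∀ {x} → x ≢ c → T (k * conj (inv x)) ≡ 1# → T ((conj c + k) * (x + c)) ≡ N x + N c
    lift {x} x≢c Tku = trans (cong ((conj c + k) * (x + c) +_)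
        (trans (conj-* (conj c + k) (x + c)) (cong₂ _*_
          (trans (conj-+ (conj c) k) (cong (_+ conj k) (conj-involutive c))) (conj-+ x c))))
      (by (solve 8 (λ x x̄ c c̄ k k̄ u ū →
             let z = x :+ c ; z̄ = x̄ :+ c̄ in
             (c̄ :+ k) :* z :+ (c :+ k̄) :* z̄ :+ (x :* x̄ :+ c :* c̄)
             := z :* z̄ :* (k :* ū :+ k̄ :* u :+ con true)
                :+ k :* z :* (ū :* z̄ :+ con true) :+ k̄ :* z̄ :* (u :* z :+ con true))
           refl x (conj x) c (conj c) k (conj k) u (conj u))
         ((x + c) * (conj x + conj c) ⊛ Tku′
           ⊕ k * (x + c) ⊛ trans (cong (conj u *_) (sym (conj-+ x c))) (conj-inverse (inv-eq x≢c))
           ⊕ conj k * (conj x + conj c) ⊛ inv-eq x≢c))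
      where
      u = inv x
      Tku′ : k * conj u + conj k * u ≡ 1#
      Tku′ = trans (cong (k * conj u +_) (sym (trans (conj-* k (conj u)) (cong (conj k *_) (conj-involutive u))))) Tku

-- Symmetries of PG(2,2)

-- `fanoLines` records each line in one order only, and an automorphism need not respect it.
orderings : FanoLine → List FanoLine
orderings (i , j , k) =
  (i , j , k) ∷ (i , k , j) ∷ (j , i , k) ∷ (j , k , i) ∷ (k , i , j) ∷ (k , j , i) ∷ []

image : Vec (Fin 7) 7 → FanoLine → FanoLine
image σ (i , j , k) = lookup σ i , lookup σ j , lookup σ k

IsAutomorphism : Vec (Fin 7) 7 → Set
IsAutomorphism σ =
  All (λ ℓ → image σ ℓ ∈ concatMap orderings fanoLines) fanoLines ×
  (∀ i j → lookup σ i ≡ lookup σ j → i ≡ j) × (∀ p → ∃ λ i → lookup σ i ≡ p)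

_≟ₗ_ : DecidableEquality FanoLine
_≟ₗ_ = ≡-dec Finₚ._≟_ (≡-dec Finₚ._≟_ Finₚ._≟_)

isAutomorphism? : ∀ σ → Dec (IsAutomorphism σ)
isAutomorphism? σ =
  All.all? (λ ℓ → image σ ℓ ∈? concatMap orderings fanoLines) fanoLines ×-dec
  Finₚ.all? (λ i → Finₚ.all? λ j → (lookup σ i Finₚ.≟ lookup σ j) →-dec (i Finₚ.≟ j)) ×-dec
  Finₚ.all? (λ p → Finₚ.any? λ i → lookup σ i Finₚ.≟ p)
  where open DecMembership _≟ₗ_

-- Enough automorphisms of PG(2,2) to move the line {0,1,2} to each line and the point 0 to each point.
automorphisms : List (Vec (Fin 7) 7)
automorphisms =
  (# 0 ∷ # 1 ∷ # 2 ∷ # 3 ∷ # 4 ∷ # 5 ∷ # 6 ∷ []) ∷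
  (# 0 ∷ # 3 ∷ # 4 ∷ # 1 ∷ # 2 ∷ # 5 ∷ # 6 ∷ []) ∷
  (# 0 ∷ # 5 ∷ # 6 ∷ # 1 ∷ # 2 ∷ # 3 ∷ # 4 ∷ []) ∷
  (# 1 ∷ # 3 ∷ # 5 ∷ # 0 ∷ # 2 ∷ # 4 ∷ # 6 ∷ []) ∷
  (# 1 ∷ # 4 ∷ # 6 ∷ # 0 ∷ # 2 ∷ # 3 ∷ # 5 ∷ []) ∷
  (# 2 ∷ # 3 ∷ # 6 ∷ # 0 ∷ # 1 ∷ # 4 ∷ # 5 ∷ []) ∷
  (# 2 ∷ # 4 ∷ # 5 ∷ # 0 ∷ # 1 ∷ # 3 ∷ # 6 ∷ []) ∷
  (# 3 ∷ # 0 ∷ # 4 ∷ # 1 ∷ # 5 ∷ # 2 ∷ # 6 ∷ []) ∷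
  (# 4 ∷ # 0 ∷ # 3 ∷ # 1 ∷ # 6 ∷ # 2 ∷ # 5 ∷ []) ∷
  (# 5 ∷ # 0 ∷ # 6 ∷ # 1 ∷ # 3 ∷ # 2 ∷ # 4 ∷ []) ∷
  (# 6 ∷ # 0 ∷ # 5 ∷ # 1 ∷ # 4 ∷ # 2 ∷ # 3 ∷ []) ∷ []

abstract

  areAutomorphisms : All IsAutomorphism automorphisms
  areAutomorphisms = from-yes (All.all? isAutomorphism? automorphisms)

  automorphism-point : ∀ p → ∃ λ σ → IsAutomorphism σ × lookup σ (# 0) ≡ p
  automorphism-point p with σ , σ∈ , eq ← find (from-yes
    (Finₚ.all? λ p → Any.any? (λ σ → lookup σ (# 0) Finₚ.≟ p) automorphisms) p) =
    σ , All.lookup areAutomorphisms σ∈ , eq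

  automorphism-line : ∀ {ℓ} → ℓ ∈ fanoLines → ∃ λ σ → IsAutomorphism σ × image σ (# 0 , # 1 , # 2) ≡ ℓ
  automorphism-line ℓ∈ with σ , σ∈ , eq ← find (All.lookup (from-yes
    (All.all? (λ ℓ → Any.any? (λ σ → image σ (# 0 , # 1 , # 2) ≟ₗ ℓ) automorphisms) fanoLines)) ℓ∈) =
    σ , All.lookup areAutomorphisms σ∈ , eq

∧⁻ : ∀ {x y} → x ∧ y ≡ true → x ≡ true × y ≡ true
∧⁻ {true} {true} refl = refl , refl

-- Fano labellings in PG(2,q²)

module Fano {m : ℕ} (F : FiniteField m) where
  open FiniteField F
  open FieldProperties F
  open Unital F using (by; _⊕_; _⊛_)
  open Solver using (solve; _:=_; _:+_; _:*_; :-_; con)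

  ==⁺ : ∀ {x y} → x ≡ y → (x == y) ≡ true
  ==⁺ {x} {y} eq = trans (isYes≗does (x ≟ y)) (dec-true (x ≟ y) eq)

  ==⁻ : ∀ {x y} → (x == y) ≡ true → x ≡ y
  ==⁻ {x} {y} eq with x ≟ y
  ... | yes p = p

  samePoint-refl : ∀ P → samePoint P P ≡ true
  samePoint-refl (x , y , z) = cong₂ _∧_ (==⁺ (*-comm x y)) (cong₂ _∧_ (==⁺ (*-comm x z)) (==⁺ (*-comm y z)))

  -- The projective line x = c z; in this form `T∞` lies on it for every c.
  OnColumn : Carrier → Point → Set
  OnColumn c (x , _ , z) = x ≡ c * z

  -- The nondegeneracy `no-column` refers to no particular Fano line, so it passes through `relabel`
  -- directly.
  record IsFano (f : Fin 7 → Point) : Set where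
    field
      distinct  : ∀ {i j} → i ≢ j → f i ≢ f j
      lines     : ∀ {i j k} → (i , j , k) ∈ fanoLines → det (f i) (f j) (f k) ≡ 0#
      no-column : ∀ c → ¬ (∀ i → OnColumn c (f i))

  det-column : ∀ c {P₁ P₂ P₃} → OnColumn c P₁ → OnColumn c P₂ → OnColumn c P₃ → det P₁ P₂ P₃ ≡ 0#
  det-column c {_ , y₁ , z₁} {_ , y₂ , z₂} {_ , y₃ , z₃} refl refl refl =
    solve 7 (λ c y₁ z₁ y₂ z₂ y₃ z₃ →
      (c :* z₁) :* (y₂ :* z₃ :+ :- (z₂ :* y₃)) :+ :- (y₁ :* ((c :* z₂) :* z₃ :+ :- (z₂ :* (c :* z₃))))
      :+ z₁ :* ((c :* z₂) :* y₃ :+ :- (y₂ :* (c :* z₃))) := con false) refl c y₁ z₁ y₂ z₂ y₃ z₃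

  distinctAt : (Fin 7 → Point) → Fin 7 → Fin 7 → Bool
  distinctAt f i j = (i ==ᶠ j) ∨ not (samePoint (f i) (f j))

  offLine : (Fin 7 → Point) → FanoLine → Fin 7 → Bool
  offLine f (i , j , k) p = onLine p (i , j , k) ∨ not (collinear (f i) (f j) (f p))

  lineAt : (Fin 7 → Point) → FanoLine → Bool
  lineAt f (i , j , k) = all (offLine f (i , j , k)) allFin7 ∧ collinear (f i) (f j) (f k)

  throughT∞ : (Fin 7 → Point) → FanoLine → Bool
  throughT∞ f (i , j , k) = collinear (f i) (f j) T∞

  -- A labelling is tested only through coincidence and collinearity of its points, both of which a
  -- collineation preserves.
  isFanoLabelling-cong : ∀ {f g} → (∀ i j → samePoint (f i) (f j) ≡ samePoint (g i) (g j)) →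
    (∀ i j k → collinear (f i) (f j) (f k) ≡ collinear (g i) (g j) (g k)) →
    isFanoLabelling f ≡ isFanoLabelling g
  isFanoLabelling-cong {f} {g} same coll = cong₂ _∧_
    (all-cong {p = λ i → all (distinctAt f i) allFin7} {p′ = λ i → all (distinctAt g i) allFin7} allFin7 λ i →
       all-cong {p = distinctAt f i} {p′ = distinctAt g i} allFin7 λ j →
         cong (λ t → (i ==ᶠ j) ∨ not t) (same i j))
    (all-cong {p = lineAt f} {p′ = lineAt g} fanoLines λ { (i , j , k) → cong₂ _∧_
       (all-cong {p = offLine f (i , j , k)} {p′ = offLine g (i , j , k)} allFin7 λ p →
         cong (λ t → onLine p (i , j , k) ∨ not t) (coll i j p))
       (coll i j k) })

  labelling⇒IsFano : ∀ f → isFanoLabelling f ≡ true → IsFano f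
  labelling⇒IsFano f lab = record { distinct = distinct ; lines = lines ; no-column = no-column }
    where
    split = ∧⁻ {all (λ i → all (distinctAt f i) allFin7) allFin7} {all (lineAt f) fanoLines} lab
    ∈allFin7 : ∀ i → i ∈ allFin7
    ∈allFin7 = ∈-tabulate⁺
    line : ∀ {ℓ} → ℓ ∈ fanoLines → lineAt f ℓ ≡ true
    line = all⁻ (lineAt f) (proj₂ split)
    distinct : ∀ {i j} → i ≢ j → f i ≢ f j
    distinct {i} {j} i≢j fi≡fj with () ← trans (sym (cong₂ _∨_
        (trans (isYes≗does (toℕ i ℕ.≟ toℕ j)) (dec-false (toℕ i ℕ.≟ toℕ j) (i≢j ∘ Finₚ.toℕ-injective)))
        (cong not (trans (cong (samePoint (f i)) (sym fi≡fj)) (samePoint-refl (f i))))))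
      (all⁻ (distinctAt f i) (all⁻ (λ i → all (distinctAt f i) allFin7) (proj₁ split) (∈allFin7 i)) (∈allFin7 j))
    lines : ∀ {i j k} → (i , j , k) ∈ fanoLines → det (f i) (f j) (f k) ≡ 0#
    lines {i} {j} {k} ℓ∈ =
      ==⁻ (proj₂ (∧⁻ {all (offLine f (i , j , k)) allFin7} {collinear (f i) (f j) (f k)} (line ℓ∈)))
    -- The points 0, 1 and 3 are on no common Fano line, but a common column would make them
    -- collinear.
    no-column : ∀ c → ¬ (∀ i → OnColumn c (f i))
    no-column c on with () ← trans (sym (cong not
        (==⁺ (det-column c {f (# 0)} {f (# 1)} {f (# 3)} (on (# 0)) (on (# 1)) (on (# 3))))))
      (all⁻ (offLine f (# 0 , # 1 , # 2)) (proj₁ (∧⁻ {all (offLine f (# 0 , # 1 , # 2)) allFin7}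
        {collinear (f (# 0)) (f (# 1)) (f (# 2))} (line (here refl)))) (∈allFin7 (# 3)))

  det-swap₂₃ : ∀ P Q R → det P R Q ≡ det P Q R
  det-swap₂₃ (x₁ , y₁ , z₁) (x₂ , y₂ , z₂) (x₃ , y₃ , z₃) =
    solve 9 (λ x₁ y₁ z₁ x₂ y₂ z₂ x₃ y₃ z₃ →
      let D = λ x₁ y₁ z₁ x₂ y₂ z₂ x₃ y₃ z₃ →
            x₁ :* (y₂ :* z₃ :+ :- (z₂ :* y₃)) :+ :- (y₁ :* (x₂ :* z₃ :+ :- (z₂ :* x₃)))
            :+ z₁ :* (x₂ :* y₃ :+ :- (y₂ :* x₃))
      in D x₁ y₁ z₁ x₃ y₃ z₃ x₂ y₂ z₂ := D x₁ y₁ z₁ x₂ y₂ z₂ x₃ y₃ z₃)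
      refl x₁ y₁ z₁ x₂ y₂ z₂ x₃ y₃ z₃

  det-swap₁₂ : ∀ P Q R → det Q P R ≡ det P Q R
  det-swap₁₂ (x₁ , y₁ , z₁) (x₂ , y₂ , z₂) (x₃ , y₃ , z₃) =
    solve 9 (λ x₁ y₁ z₁ x₂ y₂ z₂ x₃ y₃ z₃ →
      let D = λ x₁ y₁ z₁ x₂ y₂ z₂ x₃ y₃ z₃ →
            x₁ :* (y₂ :* z₃ :+ :- (z₂ :* y₃)) :+ :- (y₁ :* (x₂ :* z₃ :+ :- (z₂ :* x₃)))
            :+ z₁ :* (x₂ :* y₃ :+ :- (y₂ :* x₃))
      in D x₂ y₂ z₂ x₁ y₁ z₁ x₃ y₃ z₃ := D x₁ y₁ z₁ x₂ y₂ z₂ x₃ y₃ z₃)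
      refl x₁ y₁ z₁ x₂ y₂ z₂ x₃ y₃ z₃

  relabel : ∀ {f} σ → IsFano f → IsAutomorphism σ → IsFano (f ∘ lookup σ)
  relabel {f} σ fano (σ-lines , σ-injective , σ-surjective) = record
    { distinct  = λ i≢j → F.distinct (i≢j ∘ σ-injective _ _)
    ; lines     = λ ℓ∈ → ordered (All.lookup σ-lines ℓ∈)
    ; no-column = λ c on → F.no-column c (λ p → let i , eq = σ-surjective p in
                    subst (OnColumn c ∘ f) eq (on i))
    }
    where
    module F = IsFano fano
    ordered : ∀ {i j k} → (i , j , k) ∈ concatMap orderings fanoLines → det (f i) (f j) (f k) ≡ 0#
    ordered ℓ∈ with (i , j , k) , m∈ , p ← find (∈-concatMap⁻ orderings {xs = fanoLines} ℓ∈)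
      with d ← F.lines m∈ | p
    ... | here refl = d
    ... | there (here refl) = trans (det-swap₂₃ (f i) (f j) (f k)) d
    ... | there (there (here refl)) = trans (det-swap₁₂ (f i) (f j) (f k)) d
    ... | there (there (there (here refl))) =
          trans (det-swap₂₃ (f j) (f i) (f k)) (trans (det-swap₁₂ (f i) (f j) (f k)) d)
    ... | there (there (there (there (here refl)))) =
          trans (det-swap₁₂ (f i) (f k) (f j)) (trans (det-swap₂₃ (f i) (f j) (f k)) d)
    ... | there (there (there (there (there (here refl))))) =
          trans (det-swap₁₂ (f j) (f k) (f i)) (trans (det-swap₂₃ (f j) (f i) (f k))
            (trans (det-swap₁₂ (f i) (f j) (f k)) d))

-- Membership in the unital and the exclusion of `T∞`

module SpecialFano {m : ℕ} (F : FiniteField m)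
  (b : FiniteField.Carrier F) (bm : FiniteField.IsOrthogonalBM F (FiniteField.1# F) b) where
  open FiniteField F
  open FieldProperties F
  open Unital F
  open Anisotropy b bm
  open Configurations F b bm
  open Fano F
  open Solver using (solve; _:=_; _:+_; _:*_; :-_; con)

  IsAffine : Point → Set
  IsAffine P = ∃₂ λ x y → P ≡ (x , y , 1#) × OnUnital (x , y)

  pointAt : Carrier → Carrier → Point
  pointAt x r = x , 1# * (x ^ 2) + b * (x ^ (q ℕ.+ 1)) + r , 1#

  pointAt-y : ∀ x r → 1# * (x ^ 2) + b * (x ^ (q ℕ.+ 1)) + r ≡ x * x + b * N x + r
  pointAt-y x r = cong (_+ r) (cong₂ _+_ (trans (*-identityˡ (x ^ 2)) (^2 x)) (cong (b *_) (^[q+1] x)))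

  T[x²+bNx] : ∀ x → T (x * x + b * N x) ≡ Q β x
  T[x²+bNx] x = begin
    T (x * x + b * N x)         ≡⟨ T-+ (x * x) (b * N x) ⟩
    T (x * x) + T (b * N x)     ≡⟨ cong₂ _+_
      (trans (cong (x * x +_) (conj-* x x))
        (solve 2 (λ x x̄ → x :* x :+ x̄ :* x̄ := (x :+ x̄) :* (x :+ x̄)) refl x (conj x)))
      (trans (cong T (*-comm b (N x))) (trans (T-* (conj-N x) b) (*-comm (N x) β))) ⟩
    Q β x                       ∎
    where open ≡-Reasoning

  ∈unital⁻ : ∀ {P} → P ∈ unitalPoints 1# b → P ≡ T∞ ⊎ IsAffine P
  ∈unital⁻ (here eq) = inj₁ eq
  ∈unital⁻ (there p) with x , _ , s ← find (∈-concatMap⁻ (λ x → List.map (pointAt x) Fq) {xs = elems} p)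
    with r , r∈ , refl ← ∈-map⁻ (pointAt x) s =
    inj₂ (x , _ , refl , (begin
      T (1# * (x ^ 2) + b * (x ^ (q ℕ.+ 1)) + r) ≡⟨ cong T (pointAt-y x r) ⟩
      T (x * x + b * N x + r)                    ≡⟨ T-+ _ r ⟩
      T (x * x + b * N x) + T r                  ≡⟨ cong₂ _+_ (T[x²+bNx] x)
                                                      (T-0 (proj₂ (∈-filter⁻ (λ r → r ^ q ≟ r) {xs = elems} r∈))) ⟩
      Q β x + 0#                                 ≡⟨ +-identityʳ (Q β x) ⟩
      Q β x                                      ∎))
    where open ≡-Reasoning

  ∈unital⁺ : ∀ {x y} → OnUnital (x , y) → (x , y , 1#) ∈ unitalPoints 1# b
  ∈unital⁺ {x} {y} E = there (∈-concatMap⁺ (λ x → List.map (pointAt x) Fq) (lose (complete x)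
    (subst (λ t → (x , t , 1#) ∈ List.map (pointAt x) Fq)
      (trans (pointAt-y x r) (solve 2 (λ s y → s :+ (s :+ y) := y) refl (x * x + b * N x) y))
      (∈-map⁺ (pointAt x) (∈-filter⁺ (λ r → r ^ q ≟ r) (complete r) r∈Fq)))))
    where
    r = x * x + b * N x + y
    r∈Fq : conj r ≡ r
    r∈Fq = T≡0⇒ (trans (T-+ (x * x + b * N x) y) (≡⇒+≡0 (trans (T[x²+bNx] x) (sym E))))

  unital-unique : Unique (unitalPoints 1# b)
  unital-unique = All.tabulate T∞∉ ∷ Uniqueₚ.concat⁺
    (Allₚ.map⁺ (All.universal (λ x → Uniqueₚ.map⁺ (pointAt-injective x)
                  (Uniqueₚ.filter⁺ (λ r → r ^ q ≟ r) unique)) elems))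
    (AllPairsₚ.map⁺ (AllPairs.map disjoint unique))
    where
    column : Carrier → List Point
    column x = List.map (pointAt x) Fq
    T∞∉ : ∀ {P} → P ∈ concatMap column elems → T∞ ≢ P
    T∞∉ p refl with x , _ , s ← find (∈-concatMap⁻ column {xs = elems} p)
      with r , _ , eq ← ∈-map⁻ (pointAt x) s = 0≢1 (cong (proj₂ ∘ proj₂) eq)
    pointAt-injective : ∀ x {r s} → pointAt x r ≡ pointAt x s → r ≡ s
    pointAt-injective x {r} {s} eq = by
      (solve 3 (λ u r s → r :+ s := con true :* ((u :+ r) :+ (u :+ s))) refl _ r s)
      (1# ⊛ cong (proj₁ ∘ proj₂) eq)
    disjoint : ∀ {x x′} → x ≢ x′ → ∀ {P} → ¬ (P ∈ column x × P ∈ column x′)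
    disjoint x≢x′ (p , p′) with _ , _ , refl ← ∈-map⁻ (pointAt _) p
      with _ , _ , eq ← ∈-map⁻ (pointAt _) p′ = x≢x′ (cong proj₁ eq)

  det⇒Collinear : ∀ {x₁ y₁ x₂ y₂ x₃ y₃} → det (x₁ , y₁ , 1#) (x₂ , y₂ , 1#) (x₃ , y₃ , 1#) ≡ 0# →
                  Collinear (x₁ , y₁) (x₂ , y₂) (x₃ , y₃)
  det⇒Collinear {x₁} {y₁} {x₂} {y₂} {x₃} {y₃} eq = by
    (solve 6 (λ x₁ y₁ x₂ y₂ x₃ y₃ →
       let 1ᵖ = con true in
       (y₂ :+ y₁) :* (x₃ :+ x₁) :+ (y₃ :+ y₁) :* (x₂ :+ x₁)
       := x₁ :* (y₂ :* 1ᵖ :+ :- (1ᵖ :* y₃)) :+ :- (y₁ :* (x₂ :* 1ᵖ :+ :- (1ᵖ :* x₃))) :+ 1ᵖ :* (x₂ :* y₃ :+ :- (y₂ :* x₃)))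
       refl x₁ y₁ x₂ y₂ x₃ y₃) eq

  vertical : ∀ {x y x₂ y₂ x₃ y₃} → x₂ ≡ x → Collinear (x , y) (x₂ , y₂) (x₃ , y₃) → y₂ ≢ y → x₃ ≡ x
  vertical {x} {y} {_} {y₂} {x₃} {y₃} refl L y₂≢y = +≡0⇒≡ (*-zero-cancel (≢⇒+≢0 y₂≢y)
    (trans L (trans (cong ((y₃ + y) *_) (x+x≡0 x)) (zeroʳ (y₃ + y)))))

  Collinear-rotate : ∀ {P₁ P₂ P₃} → Collinear P₁ P₂ P₃ → Collinear P₂ P₃ P₁
  Collinear-rotate {x₁ , y₁} {x₂ , y₂} {x₃ , y₃} L = by
    (solve 6 (λ x₁ y₁ x₂ y₂ x₃ y₃ →
       (y₃ :+ y₂) :* (x₁ :+ x₂) :+ (y₁ :+ y₂) :* (x₃ :+ x₂)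
       := con true :* ((y₂ :+ y₁) :* (x₃ :+ x₁) :+ (y₃ :+ y₁) :* (x₂ :+ x₁)))
       refl x₁ y₁ x₂ y₂ x₃ y₃) (1# ⊛ L)

  -- With point 0 at `T∞` the lines through it are columns carrying the pairs {1,2}, {3,4}, {5,6},
  -- and 135, 146, 236 serve as ABC, AB′C′, A′BC′. If two of the columns coincided, ABC would be
  -- vertical and all points would share one column.
  T∞-not-first : ∀ {g} → IsFano g → (∀ i → g i ∈ unitalPoints 1# b) → g 0F ≢ T∞
  T∞-not-first {g} fano g∈ g0≡T∞ =
    no-quadrangle-T∞ (on 0F) (on′ (x₂≡) (on 1F)) (on 2F) (on′ x₄≡ (on 3F)) (on 4F)
      (λ eq → y≢ {0F} {1F} (λ ()) x₁₂ eq) a≢e a≢g e≢g ABC AB′C′ A′BC′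
    where
    module I = IsFano fano
    affine : ∀ (i : Fin 6) → IsAffine (g (suc i))
    affine i with ∈unital⁻ (g∈ (suc i))
    ... | inj₁ eq = contradiction (trans g0≡T∞ (sym eq)) (I.distinct {0F} {suc i} (λ ()))
    ... | inj₂ a  = a
    -- Index i stands for the Fano point `suc i`, since point 0 has no affine coordinates here.
    X Y : Fin 6 → Carrier
    X i = proj₁ (affine i)
    Y i = proj₁ (proj₂ (affine i))
    g≡ : ∀ i → g (suc i) ≡ (X i , Y i , 1#)
    g≡ i = proj₁ (proj₂ (proj₂ (affine i)))
    on : ∀ i → OnUnital (X i , Y i)
    on i = proj₂ (proj₂ (proj₂ (affine i)))
    on′ : ∀ {x x′ y} → x ≡ x′ → OnUnital (x , y) → OnUnital (x′ , y)
    on′ refl E = E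
    y≢ : ∀ {i j} → i ≢ j → X i ≡ X j → Y i ≢ Y j
    y≢ {i} {j} i≢j x≡ y≡ = I.distinct (i≢j ∘ Finₚ.suc-injective)
      (trans (g≡ i) (trans (cong₂ (λ x y → (x , y , 1#)) x≡ y≡) (sym (g≡ j))))
    through-T∞ : ∀ {i j} → (0F , suc i , suc j) ∈ fanoLines → X j ≡ X i
    through-T∞ {i} {j} ℓ∈ = by
      (solve 4 (λ x y x′ y′ → let 0ᵖ = con false ; 1ᵖ = con true in
         x′ :+ x := 0ᵖ :* (y :* 1ᵖ :+ :- (1ᵖ :* y′)) :+ :- (1ᵖ :* (x :* 1ᵖ :+ :- (1ᵖ :* x′))) :+ 0ᵖ :* (x :* y′ :+ :- (y :* x′)))
         refl (X i) (Y i) (X j) (Y j))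
      (trans (cong₂ (det T∞) (sym (g≡ i)) (sym (g≡ j)))
        (trans (cong (λ P → det P (g (suc i)) (g (suc j))) (sym g0≡T∞)) (I.lines ℓ∈)))
    line : ∀ {i j k} → (suc i , suc j , suc k) ∈ fanoLines → Collinear (X i , Y i) (X j , Y j) (X k , Y k)
    line {i} {j} {k} ℓ∈ = det⇒Collinear (trans (cong₂ (λ P R → det P R (X k , Y k , 1#)) (sym (g≡ i)) (sym (g≡ j)))
      (trans (cong (det (g (suc i)) (g (suc j))) (sym (g≡ k))) (I.lines ℓ∈)))
    x₂≡ : X 1F ≡ X 0F
    x₂≡ = through-T∞ (here refl)
    x₁₂ = sym x₂≡
    x₄≡ : X 3F ≡ X 2F
    x₄≡ = through-T∞ (there (here refl))
    x₆≡ : X 5F ≡ X 4F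
    x₆≡ = through-T∞ (there (there (here refl)))
    ABC : Collinear (X 0F , Y 0F) (X 2F , Y 2F) (X 4F , Y 4F)
    ABC = line (there (there (there (here refl))))
    AB′C′ : Collinear (X 0F , Y 0F) (X 2F , Y 3F) (X 4F , Y 5F)
    AB′C′ = subst₂ (λ e g → Collinear (X 0F , Y 0F) (e , Y 3F) (g , Y 5F)) x₄≡ x₆≡
      (line (there (there (there (there (here refl))))))
    A′BC′ : Collinear (X 0F , Y 1F) (X 2F , Y 2F) (X 4F , Y 5F)
    A′BC′ = subst₂ (λ a g → Collinear (a , Y 1F) (X 2F , Y 2F) (g , Y 5F)) x₂≡ x₆≡
      (line (there (there (there (there (there (here refl)))))))
    all-equal : X 2F ≡ X 0F → X 4F ≡ X 0F → ⊥
    all-equal e g = I.no-column (X 0F) λ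
      { 0F      → subst (OnColumn (X 0F)) (sym g0≡T∞) (sym (zeroʳ (X 0F)))
      ; (suc i) → subst (OnColumn (X 0F)) (sym (g≡ i)) (trans (x≡ i) (sym (*-identityʳ (X 0F)))) }
      where
      x≡ : ∀ i → X i ≡ X 0F
      x≡ 0F = refl
      x≡ 1F = x₂≡
      x≡ 2F = e
      x≡ 3F = trans x₄≡ e
      x≡ 4F = g
      x≡ 5F = trans x₆≡ g
    a≢e : X 0F ≢ X 2F
    a≢e eq = all-equal (sym eq) (vertical (sym eq) ABC (y≢ {2F} {0F} (λ ()) (sym eq)))
    a≢g : X 0F ≢ X 4F
    a≢g eq = all-equal (vertical (sym eq) (sym ABC) (y≢ {4F} {0F} (λ ()) (sym eq))) (sym eq)
    e≢g : X 2F ≢ X 4F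
    e≢g eq = a≢e (vertical (sym eq) (Collinear-rotate ABC) (y≢ {4F} {2F} (λ ()) (sym eq)))

  T∞∉Fano : ∀ {f} → IsFano f → (∀ i → f i ∈ unitalPoints 1# b) → ∀ p → f p ≢ T∞
  T∞∉Fano {f} fano f∈ p fp≡T∞ =
    let σ , aut , eq = automorphism-point p in
    T∞-not-first (relabel σ fano aut) (f∈ ∘ lookup σ) (trans (cong f eq) fp≡T∞)

-- The column c and the element h attached to a BM-special plane

module Frames {m : ℕ} (F : FiniteField m)
  (b : FiniteField.Carrier F) (bm : FiniteField.IsOrthogonalBM F (FiniteField.1# F) b) where
  open FiniteField F
  open FieldProperties F
  open Unital F
  open Anisotropy b bm
  open Configurations F b bm
  open Fano F
  open SpecialFano F b bm
  open Solver using (solve; _:=_; _:+_; _:*_; :-_; con)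

  -- The first two fields identify c among the x-coordinates; the last two identify h. Stated for a
  -- set `M` of points, the data pass from a labelling to the unlabelled plane.
  record Frame (M : Point → Set) (c h : Carrier) : Set where
    field
      two-on-column : ∃₂ λ y y′ → y ≢ y′ × M (c , y , 1#) × M (c , y′ , 1#)
      only-column   : ∀ {x y y′} → M (x , y , 1#) → M (x , y′ , 1#) → y ≢ y′ → x ≡ c
      balanced      : ∀ {P} → M P →
                      ∃₂ λ x y → P ≡ (x , y , 1#) × OnUnital (x , y) × T (h * (x + c)) ≡ N x + N c
      spread        : ∃₂ λ x₁ x₂ → ∃₂ λ y₁ y₂ → M (x₁ , y₁ , 1#) × M (x₂ , y₂ , 1#) ×
                      T ((x₁ + c) * conj (x₂ + c)) ≢ 0#

  Frame-resp : ∀ {M M′ c h} → (∀ {P} → M P → M′ P) → (∀ {P} → M′ P → M P) → Frame M c h → Frame M′ c h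
  Frame-resp to from frame = record
    { two-on-column = let y , y′ , y≢ , p , p′ = two-on-column in y , y′ , y≢ , to p , to p′
    ; only-column   = λ p p′ → only-column (from p) (from p′)
    ; balanced      = λ p → balanced (from p)
    ; spread        = let x₁ , x₂ , y₁ , y₂ , p₁ , p₂ , t = spread in x₁ , x₂ , y₁ , y₂ , to p₁ , to p₂ , t
    }
    where open Frame frame

  Image : (Fin 7 → Point) → Point → Set
  Image f P = ∃ λ i → f i ≡ P

  -- The special line is 012, so 3, 4, 5, 6 form the quadrangle and 0, 1, 2 are its diagonal points.
  frame-first : ∀ {g} → IsFano g → (∀ i → IsAffine (g i)) → det (g 0F) (g 1F) T∞ ≡ 0# → ∃₂ (Frame (Image g))
  frame-first {g} fano affine d₀₁∞ = c , proj₁ H , record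
    { two-on-column = Y 0F , Y 1F , (λ eq → y≢ {0F} {1F} (λ ()) (sym x₁≡) eq) ,
                      (0F , g≡ 0F) , (1F , trans (g≡ 1F) (cong (λ x → (x , Y 1F , 1#)) x₁≡))
    ; only-column   = only-column
    ; balanced      = balanced
    ; spread        = X 3F , X 4F , Y 3F , Y 4F , (3F , g≡ 3F) , (4F , g≡ 4F) ,
                      T-z₁z̄₂≢0 (on 0F) (on 3F) (on 4F) L₀₃₄ x₃≢c x₄≢c (x≢ L₀₃₄ (λ ()) x₃≢c)
    }
    where
    module I = IsFano fano
    X Y : Fin 7 → Carrier
    X i = proj₁ (affine i)
    Y i = proj₁ (proj₂ (affine i))
    g≡ : ∀ i → g i ≡ (X i , Y i , 1#)
    g≡ i = proj₁ (proj₂ (proj₂ (affine i)))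
    on : ∀ i → OnUnital (X i , Y i)
    on i = proj₂ (proj₂ (proj₂ (affine i)))
    c = X 0F
    y≢ : ∀ {i j} → i ≢ j → X i ≡ X j → Y i ≢ Y j
    y≢ {i} {j} i≢j x≡ y≡ = I.distinct i≢j
      (trans (g≡ i) (trans (cong₂ (λ x y → (x , y , 1#)) x≡ y≡) (sym (g≡ j))))
    line : ∀ {i j k} → (i , j , k) ∈ fanoLines → Collinear (X i , Y i) (X j , Y j) (X k , Y k)
    line {i} {j} {k} ℓ∈ = det⇒Collinear (trans (cong₂ (λ P R → det P R (X k , Y k , 1#)) (sym (g≡ i)) (sym (g≡ j)))
      (trans (cong (det (g i) (g j)) (sym (g≡ k))) (I.lines ℓ∈)))
    x₁≡ : X 1F ≡ c
    x₁≡ = by (solve 4 (λ x y x′ y′ → let 0ᵖ = con false ; 1ᵖ = con true in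
         x′ :+ x := x :* (y′ :* 0ᵖ :+ :- (1ᵖ :* 1ᵖ)) :+ :- (y :* (x′ :* 0ᵖ :+ :- (1ᵖ :* 0ᵖ))) :+ 1ᵖ :* (x′ :* 1ᵖ :+ :- (y′ :* 0ᵖ)))
         refl c (Y 0F) (X 1F) (Y 1F))
      (trans (cong₂ (λ P R → det P R T∞) (sym (g≡ 0F)) (sym (g≡ 1F))) d₀₁∞)
    x₂≡ : X 2F ≡ c
    x₂≡ = vertical x₁≡ (line (here refl)) (y≢ {1F} {0F} (λ ()) x₁≡)
    L₀₃₄ : Collinear (c , Y 0F) (X 3F , Y 3F) (X 4F , Y 4F)
    L₀₃₄ = line (there (here refl))
    L₀₅₆ : Collinear (c , Y 0F) (X 5F , Y 5F) (X 6F , Y 6F)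
    L₀₅₆ = line (there (there (here refl)))
    L₁₃₅ : Collinear (c , Y 1F) (X 3F , Y 3F) (X 5F , Y 5F)
    L₁₃₅ = subst (λ x → Collinear (x , Y 1F) (X 3F , Y 3F) (X 5F , Y 5F)) x₁≡
      (line (there (there (there (here refl)))))
    L₁₄₆ : Collinear (c , Y 1F) (X 4F , Y 4F) (X 6F , Y 6F)
    L₁₄₆ = subst (λ x → Collinear (x , Y 1F) (X 4F , Y 4F) (X 6F , Y 6F)) x₁≡
      (line (there (there (there (there (here refl))))))
    L₂₃₆ : Collinear (c , Y 2F) (X 3F , Y 3F) (X 6F , Y 6F)
    L₂₃₆ = subst (λ x → Collinear (x , Y 2F) (X 3F , Y 3F) (X 6F , Y 6F)) x₂≡
      (line (there (there (there (there (there (here refl)))))))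
    L₂₄₅ : Collinear (c , Y 2F) (X 4F , Y 4F) (X 5F , Y 5F)
    L₂₄₅ = subst (λ x → Collinear (x , Y 2F) (X 4F , Y 4F) (X 5F , Y 5F)) x₂≡
      (line (there (there (there (there (there (there (here refl))))))))
    onto : ∀ {i j k} → i ≢ j → X j ≡ c → Collinear (c , Y j) (X i , Y i) (X k , Y k) → X i ≡ c → X k ≡ c
    onto i≢j xj≡ L xi≡ = vertical xi≡ L (y≢ i≢j (trans xi≡ (sym xj≡)))
    x₃≢c : X 3F ≢ c
    x₃≢c x₃≡ = I.no-column c (λ i → subst (OnColumn c) (sym (g≡ i)) (trans (x≡ i) (sym (*-identityʳ c))))
      where
      x≡ : ∀ i → X i ≡ c
      x≡ 0F = refl
      x≡ 1F = x₁≡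
      x≡ 2F = x₂≡
      x≡ 3F = x₃≡
      x≡ 4F = onto {3F} {0F} {4F} (λ ()) refl L₀₃₄ x₃≡
      x≡ 5F = onto {3F} {1F} {5F} (λ ()) x₁≡ L₁₃₅ x₃≡
      x≡ 6F = onto {3F} {2F} {6F} (λ ()) x₂≡ L₂₃₆ x₃≡
    x₄≢c : X 4F ≢ c
    x₄≢c eq = x₃≢c (onto {4F} {0F} {3F} (λ ()) refl (sym L₀₃₄) eq)
    x₅≢c : X 5F ≢ c
    x₅≢c eq = x₃≢c (onto {5F} {1F} {3F} (λ ()) x₁≡ (sym L₁₃₅) eq)
    x₆≢c : X 6F ≢ c
    x₆≢c eq = x₃≢c (onto {6F} {2F} {3F} (λ ()) x₂≡ (sym L₂₃₆) eq)
    x≢ : ∀ {d i j} → Collinear (c , d) (X i , Y i) (X j , Y j) → i ≢ j → X i ≢ c → X i ≢ X j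
    x≢ L i≢j xi≢c xi≡xj = xi≢c (sym (vertical (sym xi≡xj) (Collinear-rotate L) (y≢ i≢j xi≡xj ∘ sym)))
    -- Two points off the column c span a line that meets it in a Fano point; if they shared an
    -- x-coordinate, this line would be a column different from c.
    repeated : ∀ i j → i ≢ j → X i ≡ X j → X i ≡ c
    repeated 0F j  _ _  = refl
    repeated 1F j  _ _  = x₁≡
    repeated 2F j  _ _  = x₂≡
    repeated i  0F _ eq = eq
    repeated i  1F _ eq = trans eq x₁≡
    repeated i  2F _ eq = trans eq x₂≡
    repeated 3F 3F ne _ = contradiction refl ne
    repeated 4F 4F ne _ = contradiction refl ne
    repeated 5F 5F ne _ = contradiction refl ne
    repeated 6F 6F ne _ = contradiction refl ne
    repeated 3F 4F ne eq = contradiction eq (x≢ L₀₃₄ ne x₃≢c)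
    repeated 4F 3F ne eq = contradiction eq (x≢ (sym L₀₃₄) ne x₄≢c)
    repeated 5F 6F ne eq = contradiction eq (x≢ L₀₅₆ ne x₅≢c)
    repeated 6F 5F ne eq = contradiction eq (x≢ (sym L₀₅₆) ne x₆≢c)
    repeated 3F 5F ne eq = contradiction eq (x≢ L₁₃₅ ne x₃≢c)
    repeated 5F 3F ne eq = contradiction eq (x≢ (sym L₁₃₅) ne x₅≢c)
    repeated 4F 6F ne eq = contradiction eq (x≢ L₁₄₆ ne x₄≢c)
    repeated 6F 4F ne eq = contradiction eq (x≢ (sym L₁₄₆) ne x₆≢c)
    repeated 3F 6F ne eq = contradiction eq (x≢ L₂₃₆ ne x₃≢c)
    repeated 6F 3F ne eq = contradiction eq (x≢ (sym L₂₃₆) ne x₆≢c)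
    repeated 4F 5F ne eq = contradiction eq (x≢ L₂₄₅ ne x₄≢c)
    repeated 5F 4F ne eq = contradiction eq (x≢ (sym L₂₄₅) ne x₅≢c)
    only-column : ∀ {x y y′} → Image g (x , y , 1#) → Image g (x , y′ , 1#) → y ≢ y′ → x ≡ c
    only-column {x} {y} {y′} (i , gi≡) (j , gj≡) y≢y′ =
      trans (sym xi≡) (repeated i j (λ i≡j → y≢y′ (cong (proj₁ ∘ proj₂)
        (trans (sym gi≡) (trans (cong g i≡j) gj≡)))) (trans xi≡ (sym xj≡)))
      where
      xi≡ : X i ≡ x
      xi≡ = cong proj₁ (trans (sym (g≡ i)) gi≡)
      xj≡ : X j ≡ x
      xj≡ = cong proj₁ (trans (sym (g≡ j)) gj≡)
    onColumn : ∀ {i} → X i ≡ c → OnUnital (c , Y i)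
    onColumn {i} eq = subst (λ x → OnUnital (x , Y i)) eq (on i)
    -- P₁, P₂, P₃, P₄ are the points 3, 4, 5, 6: the sides 34 and 56 pass through 0, the sides 35
    -- and 46 through 1, and 45 through 2.
    H = quadrangle (on 0F) (onColumn x₁≡) (onColumn x₂≡) (on 3F) (on 4F)
      (y≢ {0F} {1F} (λ ()) (sym x₁≡)) (y≢ {1F} {2F} (λ ()) (trans x₁≡ (sym x₂≡)))
      x₃≢c x₄≢c x₅≢c x₆≢c (x≢ L₀₃₄ (λ ()) x₃≢c) L₀₃₄ L₀₅₆ L₁₃₅ L₁₄₆ L₂₄₅
    balanced : ∀ {P} → Image g P →
               ∃₂ λ x y → P ≡ (x , y , 1#) × OnUnital (x , y) × T (proj₁ H * (x + c)) ≡ N x + N c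
    balanced (i , refl) = X i , Y i , g≡ i , on i , balance i
      where
      balance-c : ∀ {x} → x ≡ c → T (proj₁ H * (x + c)) ≡ N x + N c
      balance-c refl = trans (cong T (trans (cong (proj₁ H *_) (x+x≡0 c)) (zeroʳ (proj₁ H))))
        (trans (T-0 conj-0) (sym (x+x≡0 (N c))))
      balance : ∀ i → T (proj₁ H * (X i + c)) ≡ N (X i) + N c
      balance 0F = balance-c refl
      balance 1F = balance-c x₁≡
      balance 2F = balance-c x₂≡
      balance 3F = proj₁ (proj₂ H)
      balance 4F = proj₁ (proj₂ (proj₂ H))
      balance 5F = proj₁ (proj₂ (proj₂ (proj₂ H)))
      balance 6F = proj₂ (proj₂ (proj₂ (proj₂ H)))

  frame : ∀ {f ℓ} → IsFano f → (∀ i → f i ∈ unitalPoints 1# b) → ℓ ∈ fanoLines →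
          det (f (proj₁ ℓ)) (f (proj₁ (proj₂ ℓ))) T∞ ≡ 0# → ∃₂ (Frame (Image f))
  frame {f} fano f∈ ℓ∈ d =
    let σ , aut@(_ , _ , surjective) , eq = automorphism-line ℓ∈
        c , h , fr = frame-first (relabel σ fano aut) (affine ∘ lookup σ)
                       (trans (cong (λ (i , j , _) → det (f i) (f j) T∞) eq) d)
    in c , h , Frame-resp (λ (i , e) → lookup σ i , e)
         (λ (p , e) → let i , σi≡p = surjective p in i , trans (cong f σi≡p) e) fr
    where
    affine : ∀ i → IsAffine (f i)
    affine i with ∈unital⁻ (f∈ i)
    ... | inj₁ eq = contradiction eq (T∞∉Fano fano f∈ i)
    ... | inj₂ a  = a

-- Elations with centre `T∞`

open Vec∈ using () renaming (_∈_ to _∈ᵥ_)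

bool-ext : ∀ {x y} → (x ≡ true → y ≡ true) → (y ≡ true → x ≡ true) → x ≡ y
bool-ext {true}  to from = sym (to refl)
bool-ext {false} {true}  to from = from refl
bool-ext {false} {false} to from = refl

lookup-unique : ∀ {A : Set} {n} (v : Vec A n) → (∀ {i j} → i ≢ j → lookup v i ≢ lookup v j) → VUnique.Unique v
lookup-unique []      _  = VAP.[]
lookup-unique (x ∷ v) ne = VAllₚ.lookup⁻ (λ i → ne {zero} {suc i} (λ ())) VAP.∷
  lookup-unique v (λ {i} {j} i≢j → ne {suc i} {suc j} (i≢j ∘ Finₚ.suc-injective))

∈⇒lookup : ∀ {A : Set} {n} {v : Vec A n} {x} → x ∈ᵥ v → ∃ λ i → lookup v i ≡ x
∈⇒lookup x∈ = VAny.index x∈ , sym (VAnyₚ.lookup-index x∈)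

module Shears {m : ℕ} (F : FiniteField m) where
  open FiniteField F
  open FieldProperties F
  open Fano F
  open Solver using (solve; _:=_; _:+_; _:*_; :-_; con)

  -- Unless it is the identity, this is an elation with centre `T∞` and axis k x + s z = 0. It fixes
  -- every column, and in characteristic 2 it is its own inverse.
  shear : Carrier → Carrier → Point → Point
  shear k s (x , y , z) = x , y + k * x + s * z , z

  shear-involutive : ∀ k s P → shear k s (shear k s P) ≡ P
  shear-involutive k s (x , y , z) = cong (λ t → (x , t , z))
    (solve 3 (λ y a b → y :+ a :+ b :+ a :+ b := y) refl y (k * x) (s * z))

  shear-injective : ∀ k s {P R} → shear k s P ≡ shear k s R → P ≡ R
  shear-injective k s {P} {R} eq =
    trans (sym (shear-involutive k s P)) (trans (cong (shear k s) eq) (shear-involutive k s R))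

  det-shear : ∀ k s P₁ P₂ P₃ → det (shear k s P₁) (shear k s P₂) (shear k s P₃) ≡ det P₁ P₂ P₃
  det-shear k s (x₁ , y₁ , z₁) (x₂ , y₂ , z₂) (x₃ , y₃ , z₃) =
    solve 11 (λ k s x₁ y₁ z₁ x₂ y₂ z₂ x₃ y₃ z₃ →
      let D = λ y₁ y₂ y₃ →
            x₁ :* (y₂ :* z₃ :+ :- (z₂ :* y₃)) :+ :- (y₁ :* (x₂ :* z₃ :+ :- (z₂ :* x₃)))
            :+ z₁ :* (x₂ :* y₃ :+ :- (y₂ :* x₃))
      in D (y₁ :+ k :* x₁ :+ s :* z₁) (y₂ :+ k :* x₂ :+ s :* z₂) (y₃ :+ k :* x₃ :+ s :* z₃) := D y₁ y₂ y₃)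
      refl k s x₁ y₁ z₁ x₂ y₂ z₂ x₃ y₃ z₃

  shear-T∞ : ∀ k s → shear k s T∞ ≡ T∞
  shear-T∞ k s = cong (λ t → (0# , t , 0#))
    (trans (cong₂ (λ u v → 1# + u + v) (zeroʳ k) (zeroʳ s)) (trans (+-identityʳ _) (+-identityʳ 1#)))

  collinear-shear : ∀ k s P₁ P₂ P₃ →
    collinear (shear k s P₁) (shear k s P₂) (shear k s P₃) ≡ collinear P₁ P₂ P₃
  collinear-shear k s P₁ P₂ P₃ = cong (_== 0#) (det-shear k s P₁ P₂ P₃)

  samePoint-shear⁺ : ∀ k s P₁ P₂ → samePoint P₁ P₂ ≡ true → samePoint (shear k s P₁) (shear k s P₂) ≡ true
  samePoint-shear⁺ k s (x₁ , y₁ , z₁) (x₂ , y₂ , z₂) eq = cong₂ _∧_ (==⁺ xy′) (cong₂ _∧_ (==⁺ xz) (==⁺ yz′))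
    where
    eqs = ∧⁻ {(x₁ * y₂) == (y₁ * x₂)} eq
    eqs′ = ∧⁻ {(x₁ * z₂) == (z₁ * x₂)} (proj₂ eqs)
    xy : x₁ * y₂ ≡ y₁ * x₂
    xy = ==⁻ (proj₁ eqs)
    xz : x₁ * z₂ ≡ z₁ * x₂
    xz = ==⁻ (proj₁ eqs′)
    yz : y₁ * z₂ ≡ z₁ * y₂
    yz = ==⁻ (proj₂ eqs′)
    open Unital F using (by; _⊕_; _⊛_)
    xy′ : x₁ * (y₂ + k * x₂ + s * z₂) ≡ (y₁ + k * x₁ + s * z₁) * x₂
    xy′ = by (solve 8 (λ k s x₁ y₁ z₁ x₂ y₂ z₂ →
        x₁ :* (y₂ :+ k :* x₂ :+ s :* z₂) :+ (y₁ :+ k :* x₁ :+ s :* z₁) :* x₂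
        := con true :* (x₁ :* y₂ :+ y₁ :* x₂) :+ s :* (x₁ :* z₂ :+ z₁ :* x₂)) refl k s x₁ y₁ z₁ x₂ y₂ z₂)
      (1# ⊛ xy ⊕ s ⊛ xz)
    yz′ : (y₁ + k * x₁ + s * z₁) * z₂ ≡ z₁ * (y₂ + k * x₂ + s * z₂)
    yz′ = by (solve 8 (λ k s x₁ y₁ z₁ x₂ y₂ z₂ →
        (y₁ :+ k :* x₁ :+ s :* z₁) :* z₂ :+ z₁ :* (y₂ :+ k :* x₂ :+ s :* z₂)
        := con true :* (y₁ :* z₂ :+ z₁ :* y₂) :+ k :* (x₁ :* z₂ :+ z₁ :* x₂)) refl k s x₁ y₁ z₁ x₂ y₂ z₂)
      (1# ⊛ yz ⊕ k ⊛ xz)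

  samePoint-shear : ∀ k s P₁ P₂ → samePoint (shear k s P₁) (shear k s P₂) ≡ samePoint P₁ P₂
  samePoint-shear k s P₁ P₂ = bool-ext
    (λ eq → subst₂ (λ P R → samePoint P R ≡ true) (shear-involutive k s P₁) (shear-involutive k s P₂)
              (samePoint-shear⁺ k s (shear k s P₁) (shear k s P₂) eq))
    (samePoint-shear⁺ k s P₁ P₂)

  isFanoLabelling-shear : ∀ k s v → isFanoLabelling (lookup (Vec.map (shear k s) v)) ≡ isFanoLabelling (lookup v)
  isFanoLabelling-shear k s v = isFanoLabelling-cong
    {lookup (Vec.map (shear k s) v)} {lookup v}
    (λ i j → trans (cong₂ samePoint (at i) (at j)) (samePoint-shear k s _ _))
    (λ i j l → trans (cong (λ d → d == 0#) (det-at i j l)) (collinear-shear k s (lookup v i) (lookup v j) (lookup v l)))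
    where
    at : ∀ i → lookup (Vec.map (shear k s) v) i ≡ shear k s (lookup v i)
    at i = lookup-map i (shear k s) v
    det-at : ∀ i j l → det (lookup (Vec.map (shear k s) v) i) (lookup (Vec.map (shear k s) v) j) (lookup (Vec.map (shear k s) v) l)
                       ≡ det (shear k s (lookup v i)) (shear k s (lookup v j)) (shear k s (lookup v l))
    det-at i j l rewrite at i | at j | at l = refl

  hasLineThroughT∞-shear : ∀ k s v → hasLineThroughT∞ (lookup (Vec.map (shear k s) v)) ≡ hasLineThroughT∞ (lookup v)
  hasLineThroughT∞-shear k s v =
    any-cong {p = throughT∞ (lookup (Vec.map (shear k s) v))} {p′ = throughT∞ (lookup v)} fanoLines λ { (i , j , _) →
      trans (cong₂ (λ P R → collinear P R T∞) (lookup-map i (shear k s) v) (lookup-map j (shear k s) v))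
        (trans (cong (collinear (shear k s (lookup v i)) (shear k s (lookup v j))) (sym (shear-T∞ k s)))
          (collinear-shear k s (lookup v i) (lookup v j) T∞)) }

-- The correspondence between the two unitals

module Comparison {m : ℕ} (F : FiniteField m) (b b′ : FiniteField.Carrier F)
  (bm : FiniteField.IsOrthogonalBM F (FiniteField.1# F) b)
  (bm′ : FiniteField.IsOrthogonalBM F (FiniteField.1# F) b′) where
  open FiniteField F
  open FieldProperties F
  open Unital F
  open Fano F
  open Shears F
  open SpecialFano F b bm using (unital-unique)
  open Frames F b bm
  open Solver using (solve; _:=_; _:+_; _:*_; con)

  ψ : (c h : Carrier) → Point → Point
  ψ c h = shear k (k * c + (b + b′) * N c)
    where k = (T b + T b′) * h

  ψ-injective : ∀ c h {P R} → ψ c h P ≡ ψ c h R → P ≡ R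
  ψ-injective c h = shear-injective _ _

  -- The part k (x + c) adds (β + β′)(N(x) + N(c)) to the trace. The remaining part of s, (b + b′)
  -- N(c), has trace (β + β′) N(c) and removes the constant.
  ψ-unital : ∀ {c h x y} → T y ≡ Q (T b) x → T (h * (x + c)) ≡ N x + N c →
             ψ c h (x , y , 1#) ∈ unitalPoints 1# b′
  ψ-unital {c} {h} {x} {y} Ty Th = SpecialFano.∈unital⁺ F b′ bm′ (begin
    T (y + k * x + s * 1#) ≡⟨ cong T (solve 7 (λ y t h x c b n →
        y :+ t :* h :* x :+ (t :* h :* c :+ b :* n) :* con true := y :+ (t :* (h :* (x :+ c)) :+ n :* b))
        refl y (T b + T b′) h x c (b + b′) (N c)) ⟩
    T (y + ((T b + T b′) * (h * (x + c)) + N c * (b + b′)))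
      ≡⟨ trans (T-+ y _) (cong (T y +_) (T-+ _ _)) ⟩
    T y + (T ((T b + T b′) * (h * (x + c))) + T (N c * (b + b′)))
      ≡⟨ cong₂ _+_ Ty (cong₂ _+_ (trans (T-* t∈Fq (h * (x + c))) (cong ((T b + T b′) *_) Th))
           (trans (T-* (conj-N c) (b + b′)) (cong (N c *_) (T-+ b b′)))) ⟩
    Q (T b) x + ((T b + T b′) * (N x + N c) + N c * (T b + T b′))
      ≡⟨ solve 5 (λ w β β′ n n′ → w :+ β :* n :+ ((β :+ β′) :* (n :+ n′) :+ n′ :* (β :+ β′)) := w :+ β′ :* n)
           refl (T x * T x) (T b) (T b′) (N x) (N c) ⟩
    Q (T b′) x ∎)
    where
    open ≡-Reasoning
    k = (T b + T b′) * h
    s = k * c + (b + b′) * N c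
    t∈Fq : conj (T b + T b′) ≡ T b + T b′
    t∈Fq = trans (conj-+ (T b) (T b′)) (cong₂ _+_ (conj-T b) (conj-T b′))

  -- Here c and h are part of the witness, so two planes related to the same `S′` may at first use
  -- different collineations; `c-unique` and `h-unique` show that they do not.
  record Matches (S S′ : Vec Point 7) : Set where
    field
      {c h} : Carrier
      isFrame : Frame (_∈ᵥ S) c h
      forth    : ∀ {P} → P ∈ᵥ S → ψ c h P ∈ᵥ S′
      back     : ∀ {P′} → P′ ∈ᵥ S′ → ∃ λ P → P ∈ᵥ S × P′ ≡ ψ c h P
    open Frame isFrame public

    balance : ∀ {x y} → (x , y , 1#) ∈ᵥ S → T (h * (x + c)) ≡ N x + N c
    balance p with _ , _ , refl , _ , eq ← balanced p = eq

  pull : ∀ {S₁ S₂ S′ x y} (M₁ : Matches S₁ S′) (M₂ : Matches S₂ S′) → (x , y , 1#) ∈ᵥ S₁ →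
         ∃ λ y₂ → (x , y₂ , 1#) ∈ᵥ S₂ ×
           ψ (Matches.c M₁) (Matches.h M₁) (x , y , 1#) ≡ ψ (Matches.c M₂) (Matches.h M₂) (x , y₂ , 1#)
  pull M₁ M₂ p with (x₂ , y₂ , z₂) , p₂ , eq ← Matches.back M₂ (Matches.forth M₁ p)
    with refl ← cong proj₁ eq | refl ← cong (proj₂ ∘ proj₂) eq = y₂ , p₂ , eq

  -- Cramer's rule for h + h′ and its conjugate: the two equations are linear in them, with
  -- determinant T(z₁z̄₂).
  T-nondegenerate : ∀ {h h′ z₁ z₂} → T (z₁ * conj z₂) ≢ 0# →
                    T (h * z₁) ≡ T (h′ * z₁) → T (h * z₂) ≡ T (h′ * z₂) → h ≡ h′
  T-nondegenerate {h} {h′} {z₁} {z₂} ne eq₁ eq₂ = +≡0⇒≡ (*-zero-cancel ne (trans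
      (cong (λ t → (z₁ * conj z₂ + t) * (h + h′))
        (trans (conj-* z₁ (conj z₂)) (cong (conj z₁ *_) (conj-involutive z₂))))
      (by (solve 8 (λ h h̄ h′ h̄′ z₁ z̄₁ z₂ z̄₂ → (z₁ :* z̄₂ :+ z̄₁ :* z₂) :* (h :+ h′) :+ con false
        := z̄₂ :* ((h :* z₁ :+ h̄ :* z̄₁) :+ (h′ :* z₁ :+ h̄′ :* z̄₁))
        :+ z̄₁ :* ((h :* z₂ :+ h̄ :* z̄₂) :+ (h′ :* z₂ :+ h̄′ :* z̄₂)))
        refl h (conj h) h′ (conj h′) z₁ (conj z₁) z₂ (conj z₂))
      (conj z₂ ⊛ expand eq₁ ⊕ conj z₁ ⊛ expand eq₂))))
    where
    expand : ∀ {z} → T (h * z) ≡ T (h′ * z) → h * z + conj h * conj z ≡ h′ * z + conj h′ * conj z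
    expand {z} eq = trans (cong (h * z +_) (sym (conj-* h z)))
      (trans eq (cong (h′ * z +_) (conj-* h′ z)))

  module _ {S₁ S₂ S′} (M₁ : Matches S₁ S′) (M₂ : Matches S₂ S′) where
    private
      module M₁ = Matches M₁
      module M₂ = Matches M₂

    -- Two points of `S₁` over its c have distinct images, which come from two distinct points of
    -- `S₂` over the same x; `only-column` then applies.
    c-unique : M₁.c ≡ M₂.c
    c-unique =
      let y , y′ , y≢y′ , p , p′ = M₁.two-on-column
          y₂  , p₂  , eq  = pull M₁ M₂ p
          y₂′ , p₂′ , eq′ = pull M₁ M₂ p′
      in M₂.only-column p₂ p₂′ λ y₂≡y₂′ → y≢y′ (cong (proj₁ ∘ proj₂) (ψ-injective M₁.c M₁.h
           (trans eq (trans (cong (λ t → ψ M₂.c M₂.h (M₁.c , t , 1#)) y₂≡y₂′) (sym eq′)))))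

    h-unique : M₁.h ≡ M₂.h
    h-unique =
      let x₁ , x₂ , _ , _ , p₁ , p₂ , ne = M₁.spread
          _ , r₁ , _ = pull M₁ M₂ p₁
          _ , r₂ , _ = pull M₁ M₂ p₂
      in T-nondegenerate ne (agree p₁ r₁) (agree p₂ r₂)
      where
      agree : ∀ {x y y₂} → (x , y , 1#) ∈ᵥ S₁ → (x , y₂ , 1#) ∈ᵥ S₂ →
              T (M₁.h * (x + M₁.c)) ≡ T (M₂.h * (x + M₁.c))
      agree {x} p r = trans (M₁.balance p) (trans (cong (λ c → N x + N c) c-unique)
        (trans (sym (M₂.balance r)) (cong (λ c → T (M₂.h * (x + c))) (sym c-unique))))

    Matches-⊆ : ∀ {P} → P ∈ᵥ S₁ → P ∈ᵥ S₂
    Matches-⊆ {P} p with P₂ , p₂ , eq ← M₂.back (M₁.forth p) =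
      subst (_∈ᵥ S₂) (sym (ψ-injective M₂.c M₂.h
        (trans (cong₂ (λ c h → ψ c h P) (sym c-unique) (sym h-unique)) eq))) p₂

  specialFanos : Carrier → List (Vec Point 7)
  specialFanos b = filter (λ S → Data.Bool._≟_ (isBMSpecialFano S) true) (choose 7 (unitalPoints 1# b))

  _≟ₚ_ : (P R : Point) → Dec (P ≡ R)
  _≟ₚ_ = ≡-dec _≟_ (≡-dec _≟_ _≟_)

  isSpecial : Vec Point 7 → Bool
  isSpecial v = isFanoLabelling (lookup v) ∧ hasLineThroughT∞ (lookup v)

  IsBMSpecial : Vec Point 7 → Set
  IsBMSpecial S = isBMSpecialFano S ≡ true

  IsBMSpecial⁻ : ∀ {S} → IsBMSpecial S → ∃ λ v → v ∈ perms S ×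
                 isFanoLabelling (lookup v) ≡ true × hasLineThroughT∞ (lookup v) ≡ true
  IsBMSpecial⁻ {S} special with v , v∈ , both ← any⁻ isSpecial (perms S) special =
    v , v∈ , ∧⁻ {isFanoLabelling (lookup v)} {hasLineThroughT∞ (lookup v)} both

  IsBMSpecial⁺ : ∀ {S v} → v ∈ perms S → isFanoLabelling (lookup v) ≡ true →
                 hasLineThroughT∞ (lookup v) ≡ true → IsBMSpecial S
  IsBMSpecial⁺ v∈ labelling hasLine = any⁺ isSpecial v∈ (cong₂ _∧_ labelling hasLine)

  ψ-image-∈ : ∀ {v : Vec Point 7} {c h} → Frame (Image (lookup v)) c h →
              ∀ {P} → P ∈ᵥ Vec.map (ψ c h) v → P ∈ unitalPoints 1# b′
  ψ-image-∈ {v} {c} {h} fr p with i , eq ← ∈⇒lookup p with Frame.balanced fr (i , refl)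
  ... | _ , _ , P≡ , on , bal = subst (_∈ unitalPoints 1# b′)
        (trans (cong (ψ c h) (sym P≡)) (trans (sym (lookup-map i (ψ c h) v)) eq)) (ψ-unital on bal)

  match-frame : ∀ {S v c h} → v ∈ perms S → isFanoLabelling (lookup v) ≡ true →
                hasLineThroughT∞ (lookup v) ≡ true → Frame (Image (lookup v)) c h →
                ∃ λ S′ → S′ ∈ specialFanos b′ × Matches S S′
  match-frame {S} {v} {c} {h} v∈ labelling hasLine fr = matched
    (choose-perms _≟ₚ_ 7 (unitalPoints 1# b′) w (lookup-unique w w-distinct) (ψ-image-∈ fr))
    where
    w : Vec Point 7
    w = Vec.map (ψ c h) v
    k = (T b + T b′) * h
    s = k * c + (b + b′) * N c
    w-distinct : ∀ {i j} → i ≢ j → lookup w i ≢ lookup w j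
    w-distinct {i} {j} i≢j eq = IsFano.distinct (labelling⇒IsFano (lookup v) labelling) i≢j
      (ψ-injective c h (trans (sym (lookup-map i (ψ c h) v)) (trans eq (lookup-map j (ψ c h) v))))
    matched : (∃ λ S′ → S′ ∈ choose 7 (unitalPoints 1# b′) × w ∈ perms S′) →
              ∃ λ S′ → S′ ∈ specialFanos b′ × Matches S S′
    matched (S′ , S′∈ , w∈) = S′ ,
      ∈-filter⁺ (λ S → Data.Bool._≟_ (isBMSpecialFano S) true) S′∈
        (IsBMSpecial⁺ {S′} {w} w∈ (trans (isFanoLabelling-shear k s v) labelling)
                         (trans (hasLineThroughT∞-shear k s v) hasLine)) , record
      { isFrame = Frame-resp (λ (i , eq) → subst (_∈ᵥ S) eq (perms-∈⁻ S v∈ (∈-lookup i v)))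
                             (λ p → ∈⇒lookup (perms-∈⁺ S v∈ p)) fr
      ; forth   = λ p → perms-∈⁻ S′ w∈ (∈ᵥ-map⁺ (ψ c h) (perms-∈⁺ S v∈ p))
      ; back    = λ p′ → let i , eq = ∈⇒lookup (perms-∈⁺ S′ w∈ p′) in
          lookup v i , perms-∈⁻ S v∈ (∈-lookup i v) , trans (sym eq) (lookup-map i (ψ c h) v)
      }

  frame-of : ∀ {S v} → S ∈ choose 7 (unitalPoints 1# b) → v ∈ perms S →
             isFanoLabelling (lookup v) ≡ true → hasLineThroughT∞ (lookup v) ≡ true →
             ∃₂ (Frame (Image (lookup v)))
  frame-of {S} {v} S∈ v∈ labelling hasLine
    with (i , j , l) , ℓ∈ , through ← any⁻ (throughT∞ (lookup v)) fanoLines hasLine =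
    frame (labelling⇒IsFano (lookup v) labelling)
      (λ i → choose-⊆ 7 (unitalPoints 1# b) S∈ (perms-∈⁻ S v∈ (∈-lookup i v))) ℓ∈ (==⁻ through)

  specialFanos⁻ : ∀ {b S} → S ∈ specialFanos b → S ∈ choose 7 (unitalPoints 1# b) × IsBMSpecial S
  specialFanos⁻ {b} = ∈-filter⁻ (λ S → Data.Bool._≟_ (isBMSpecialFano S) true) {xs = choose 7 (unitalPoints 1# b)}

  match : ∀ {S} → S ∈ specialFanos b → ∃ λ S′ → S′ ∈ specialFanos b′ × Matches S S′
  match {S} S∈ = labelled (IsBMSpecial⁻ {S} (proj₂ (specialFanos⁻ {b} {S} S∈)))
    where
    labelled : (∃ λ v → v ∈ perms S × isFanoLabelling (lookup v) ≡ true × hasLineThroughT∞ (lookup v) ≡ true) →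
               ∃ λ S′ → S′ ∈ specialFanos b′ × Matches S S′
    labelled (v , v∈ , labelling , hasLine) =
      let _ , _ , fr = frame-of {S} {v} (proj₁ (specialFanos⁻ {b} {S} S∈)) v∈ labelling hasLine in
      match-frame {S} {v} v∈ labelling hasLine fr

  numBMSpecialFano-≤ : numBMSpecialFano 1# b ≤ numBMSpecialFano 1# b′
  numBMSpecialFano-≤ = length-≤ Matches (specialFanos b) (specialFanos b′)
    (Uniqueₚ.filter⁺ _ (choose-unique 7 _ unital-unique)) match
    (λ S₁∈ S₂∈ M₁ M₂ → choose-ext 7 _ unital-unique (proj₁ (∈-filter⁻ _ S₁∈)) (proj₁ (∈-filter⁻ _ S₂∈))
      (Matches-⊆ M₁ M₂) (Matches-⊆ M₂ M₁))

theorem2 : (m : ℕ) → 2 ≤ m → (F : FiniteField m) →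
    let open FiniteField F in
    (b b′ : Carrier) → IsOrthogonalBM 1# b → IsOrthogonalBM 1# b′ →
    numBMSpecialFano 1# b ≡ numBMSpecialFano 1# b′
theorem2 m _ F b b′ bm bm′ = ℕₚ.≤-antisym
  (Comparison.numBMSpecialFano-≤ F b b′ bm bm′) (Comparison.numBMSpecialFano-≤ F b′ b bm′ bm)
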